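{- Let $S \subset (0,+\infty)$. Then every $\mathbf{X} \in \mathcal{U}_S$ has a Ramsey degree $\mathrm{t}_{\mathcal{U}_S}(\mathbf{X})$ in $\mathcal{U}_S$, and $$\mathrm{t}_{\mathcal{U}_S}(\mathbf{X}) = \frac{|\mathrm{cLO}(\mathbf{X})|}{|\mathrm{iso}(\mathbf{X})|}.$$
   Context: A metric space $\mathbf{X}=(X,d^{\mathbf{X}})$ is ultrametric if $d^{\mathbf{X}}(x,z)\le \max(d^{\mathbf{X}}(x,y),d^{\mathbf{X}}(y,z))$ for all $x,y,z$. For $S\subset(0,+\infty)$, $\mathcal{U}_S$ is the class of all finite ultrametric spaces all of whose nonzero distances lie in $S$. For ultrametric spaces $\mathbf{X},\mathbf{Z}$, $\binom{\mathbf{Z}}{\mathbf{X}}$ is the set of subsets $\widetilde{\mathbf{X}}\subset \mathbf{Z}$ (with the induced metric) isometric to $\mathbf{X}$. For $k,l\ge 1$, $\mathbf{Z}\to(\mathbf{Y})^{\mathbf{X}}_{k,l}$ means: for every map $\chi:\binom{\mathbf{Z}}{\mathbf{X}}\to\{0,\dots,k-1\}$ there is $\widetilde{\mathbf{Y}}\in\binom{\mathbf{Z}}{\mathbf{Y}}$ such that $\chi$ takes at most $l$ values on $\binom{\widetilde{\mathbf{Y}}}{\mathbf{X}}$. For $\mathbf{X}\in\mathcal{U}_S$, if there exists $l\ge1$ such that for every $\mathbf{Y}\in\mathcal{U}_S$ and every $k\ge1$ there is $\mathbf{Z}\in\mathcal{U}_S$ with $\mathbf{Z}\to(\mathbf{Y})^{\mathbf{X}}_{k,l}$,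 then the least such $l$ is called the Ramsey degree $\mathrm{t}_{\mathcal{U}_S}(\mathbf{X})$ of $\mathbf{X}$ in $\mathcal{U}_S$. $\mathrm{iso}(\mathbf{X})$ is the set of isometries of $\mathbf{X}$ onto itself. A linear ordering $<$ of an ultrametric space $\mathbf{X}$ is convex if every metric ball of $\mathbf{X}$ is $<$-convex; $\mathrm{cLO}(\mathbf{X})$ is the set of all convex linear orderings of $\mathbf{X}$. -}

module Defs where

open import Level using (0ℓ)
open import Data.Nat using (ℕ; _≤_; _*_)
open import Data.Fin using (Fin)
import Data.Fin as F
open import Data.Fin.Subset using (Subset; _∈_; _⊆_)
open import Data.Maybe using (Maybe; just; nothing)
open import Data.Vec using (Vec; lookup)
open import Data.List using (List; length)
open import Data.List.Relation.Unary.Unique.Propositional using (Unique)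
import Data.List.Membership.Propositional as LM
open import Data.Unit using (⊤)
open import Data.Empty using (⊥)
open import Data.Product using (Σ; ∃; _×_; _,_)
open import Data.Sum using (_⊎_)
open import Relation.Binary.PropositionalEquality using (_≡_)
open import Relation.Binary using (Rel; IsStrictTotalOrder)
open import Function.Bundles using (_⇔_)

record DistOrder : Set₁ where
  field
    Carrier : Set
    _<_     : Rel Carrier 0ℓ
    isSTO   : IsStrictTotalOrder _≡_ _<_

HasCard : {B : Set} → (B → Set) → ℕ → Set
HasCard {B} P a =
  Σ (List B) λ xs → Unique xs × (∀ b → (b LM.∈ xs) ⇔ P b) × length xs ≡ a

module _ (S : DistOrder) where
  open DistOrder S renaming (Carrier to D; _<_ to _<ᴰ_)

  -- distance values: nothing = 0, just s = s ∈ S ; order on {0} ∪ S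
  _≤ᵈ_ : Maybe D → Maybe D → Set
  nothing ≤ᵈ _       = ⊤
  just a  ≤ᵈ nothing = ⊥
  just a  ≤ᵈ just b  = (a <ᴰ b) ⊎ (a ≡ b)

  record FUS : Set where
    field
      size  : ℕ
      d     : Fin size → Fin size → Maybe D
      d-self : ∀ x → d x x ≡ nothing
      d-pos  : ∀ x y → d x y ≡ nothing → x ≡ y
      d-sym  : ∀ x y → d x y ≡ d y x
      ultra  : ∀ x y z → (d x z ≤ᵈ d x y) ⊎ (d x z ≤ᵈ d y z)

  open FUS

  IsCopy : (X Z : FUS) → Subset (size Z) → Set
  IsCopy X Z T =
    Σ (Fin (size X) → Fin (size Z)) λ f →
      (∀ i j → d Z (f i) (f j) ≡ d X i j) ×
      (∀ z → (z ∈ T) ⇔ (∃ λ i → f i ≡ z))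

  Arrow : (Z Y X : FUS) → ℕ → ℕ → Set
  Arrow Z Y X k l =
    (χ : Subset (size Z) → Fin k) →
    Σ (Subset (size Z)) λ U → IsCopy Y Z U ×
      Σ (Vec (Fin k) l) λ cs →
        ∀ T → T ⊆ U → IsCopy X Z T → ∃ λ i → χ T ≡ lookup cs i

  RamseyBound : FUS → ℕ → Set
  RamseyBound X l =
    1 ≤ l × (∀ (Y : FUS) (k : ℕ) → 1 ≤ k → Σ FUS λ Z → Arrow Z Y X k l)

  IsRamseyDegree : FUS → ℕ → Set
  IsRamseyDegree X t = RamseyBound X t × (∀ l → RamseyBound X l → t ≤ l)

  IsIso : (X : FUS) → Vec (Fin (size X)) (size X) → Set
  IsIso X v =
    (∀ i j → d X (lookup v i) (lookup v j) ≡ d X i j) ×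
    (∀ j → ∃ λ i → lookup v i ≡ j)

  -- a linear ordering of X given by its rank bijection r : X → Fin |X|
  -- (x < y iff r x < r y); convex: every ball B(c, d(c,z)) is an interval
  IsCLO : (X : FUS) → Vec (Fin (size X)) (size X) → Set
  IsCLO X r =
    ((∀ i j → lookup r i ≡ lookup r j → i ≡ j) ×
     (∀ j → ∃ λ i → lookup r i ≡ j)) ×
    (∀ c z a b e →
       d X c a ≤ᵈ d X c z → d X c e ≤ᵈ d X c z →
       lookup r a F.< lookup r b → lookup r b F.< lookup r e →
       d X c b ≤ᵈ d X c z)

{-# OPTIONS --safe #-}
-- A convexly ordered finite ultrametric space with distances among s₁ < … < sₙ is the set of leaves of
-- an ordered tree of height n, and its order-preserving isometric embeddings are the embeddings of
-- trees. Trees of height n + 1 are finite sequences of trees of height n, so their embeddings satisfy a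
-- Ramsey theorem by induction on n, where the step is the proof of Ramsey's theorem for finite
-- sequences. Applying it once for each isomorphism type of convex ordering of X leaves at most one
-- colour per type. Conversely, fix a convex ordering of Z and colour each copy of X by the type it
-- inherits: if Y is the leaf space of a regular tree, then any convex ordering of Y is carried to the
-- lexicographic one by an isometry of Y, so every copy of Y contains all types. The isometries of X
-- act freely on its convex orderings, with the types as orbits.
module Submission where

open import Defs
open import Data.Nat using (ℕ; zero; suc; _+_; _*_; _≤_; _<_; z≤n; s≤s)
import Data.Nat.Properties as ℕₚ
import Data.Bool.Properties as Boolₚ
open import Data.Fin using (Fin; zero; suc; toℕ; fromℕ<; punchOut)
import Data.Fin as F
import Data.Fin.Properties as Finₚ
open import Data.Fin.Subset as Subset using (Subset; ∣_∣; _⊆_)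
import Data.Fin.Subset.Properties as Subsetₚ
open import Data.Maybe using (Maybe; just; nothing)
open import Data.Maybe.Properties using (≡-dec)
open import Data.Vec as Vec using (Vec; lookup; tabulate)
import Data.Vec.Properties as Vecₚ
open import Data.Vec.Properties using (lookup∘tabulate; tabulate-cong; tabulate∘lookup)
open import Data.Vec.Functional using (updateAt)
open import Data.Vec.Functional.Properties using (updateAt-updates; updateAt-minimal)
open import Data.List as List
  using (List; []; _∷_; [_]; length; _++_; concat; replicate; cartesianProductWith; allFin; filter)
open import Data.List.Properties using (length-map; length-++)
open import Data.List.Membership.Propositional using (_∈_; _∉_; lose; find)
open import Data.List.Membership.Propositional.Properties
  using (∈-map⁺; ∈-map⁻; ∈-++⁺ˡ; ∈-++⁺ʳ; ∈-++⁻; ∈-cartesianProductWith⁺; ∈-filter⁺; ∈-filter⁻; ∈-allFin; ∈-lookup)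
open import Data.List.Membership.Propositional.Properties.WithK using (unique∧set⇒bag)
open import Data.List.Relation.Binary.BagAndSetEquality using (∼bag⇒↭)
open import Data.List.Relation.Binary.Permutation.Propositional.Properties using (↭-length)
open import Data.List.Relation.Binary.Sublist.Heterogeneous.Core using (Sublist; []; _∷_; _∷ʳ_)
open import Data.List.Relation.Unary.All as All using (All; []; _∷_)
open import Data.List.Relation.Unary.AllPairs using (AllPairs; []; _∷_)
open import Data.List.Relation.Unary.Any as Any using (Any; here; there)
open import Data.List.Relation.Unary.Any.Properties using (lookup-index; ∷↔; ⊥↔Any[])
open import Data.List.Relation.Unary.Unique.Propositional using (Unique)
import Data.List.Relation.Unary.Unique.Propositional.Properties as Uniqueₚ
open import Data.Product using (Σ; ∃; _×_; _,_; proj₁; proj₂)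
open import Data.Sum using (_⊎_; inj₁; inj₂)
open import Data.Sum.Function.Propositional using (_⊎-↔_)
open import Data.Empty using (⊥; ⊥-elim)
open import Data.Unit using (⊤; tt)
open import Function using (_∘_)
open import Function.Bundles using (_⇔_; mk⇔; _↔_; Equivalence; Inverse)
open import Function.Construct.Composition using (_↔-∘_)
open import Relation.Nullary using (¬_; Dec; yes; no; contradiction; does; ¬?; _×-dec_; _⊎-dec_; _→-dec_)
open import Relation.Nullary.Decidable using (dec-true)
open import Relation.Unary using (Decidable)
open import Relation.Binary using (tri<; tri≈; tri>; IsStrictTotalOrder)
open import Relation.Binary.Definitions using (DecidableEquality)
open import Relation.Binary.PropositionalEquality
  using (_≡_; _≢_; refl; sym; trans; cong; cong₂; subst; subst₂)

-- Ramsey theory of ordered trees.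

-- Copies of `X` are sets, whereas the induction on height must split a morphism into its action on
-- the first child and on the others. A convex ordering reconciles the two: only the identity is an
-- isometry that preserves it, so a copy with its inherited ordering is the image of exactly one
-- order-preserving embedding of its type, and embeddings can be coloured in place of copies. Trees
-- are compared at one fixed height. Only finitely many members of `S` occur as distances of `X` and
-- `Y`; these fix the height, and the number of colours affects only the branching. In the lower
-- bound `Z` is arbitrary and may have distances outside this finite set, so it is not made into a
-- tree: its convex ordering is restricted to the copy of the regular tree, all of whose distances
-- are known. Since a tree that represents a space must have leaves below every vertex, the empty
-- space is treated separately.

record FinCat : Set₁ where
  field
    Obj           : Set
    Hom           : Obj → Obj → Set
    idᶜ           : ∀ A → Hom A A
    comp          : ∀ {A B C} → Hom B C → Hom A B → Hom A C
    assoc         : ∀ {A B C D} (h : Hom C D) (g : Hom B C) (f : Hom A B) →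
                    comp h (comp g f) ≡ comp (comp h g) f
    -- A colouring of pairs of morphisms becomes finitely many colourings of the second component,
    -- one for each listed first component.
    homs          : ∀ A B → List (Hom A B)
    homs-complete : ∀ {A B} (f : Hom A B) → f ∈ homs A B
    -- One object that receives all members of a list, so that a long enough constant sequence
    -- receives the whole list.
    join          : List Obj → Obj
    join-inj      : ∀ Bs → All (λ B → Hom B (join Bs)) Bs

open FinCat

-- The colour `c` is claimed even if `A` has no morphism to `B`, so a colour must exist: hence
-- `suc k`.
Ramsey : (C : FinCat) → Obj C → Set
Ramsey C A = ∀ B k → Σ (Obj C) λ Z →
  (χ : Hom C A Z → Fin (suc k)) → Σ (Hom C B Z) λ f → ∃ λ c → ∀ g → χ (comp C f g) ≡ c

-- Homogeneity survives passage to a smaller copy. The targets are therefore nested: `Z` settles the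
-- first colouring on a copy of `Z₁`, inside which the others are settled.
ramsey-multi : ∀ C q (A : Fin q → Obj C) → (∀ i → Ramsey C (A i)) → ∀ B k → Σ (Obj C) λ Z →
  (χ : ∀ i → Hom C (A i) Z → Fin (suc k)) →
  Σ (Hom C B Z) λ f → Σ (Fin q → Fin (suc k)) λ c → ∀ i g → χ i (comp C f g) ≡ c i
ramsey-multi C zero    A R B k = B , λ χ → idᶜ C B , (λ ()) , λ ()
ramsey-multi C (suc q) A R B k
  with Z₁ , P₁ ← ramsey-multi C q (A ∘ suc) (R ∘ suc) B k
  with Z , P ← R zero Z₁ k = Z , go
  where
  go : (χ : ∀ i → Hom C (A i) Z → Fin (suc k)) →
       Σ (Hom C B Z) λ f → Σ (Fin (suc q) → Fin (suc k)) λ c → ∀ i g → χ i (comp C f g) ≡ c i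
  go χ with f₀ , c₀ , e₀ ← P (χ zero)
       with f₁ , c₁ , e₁ ← P₁ (λ i g → χ (suc i) (comp C f₀ g)) =
    comp C f₀ f₁ , (λ { zero → c₀ ; (suc i) → c₁ i }) ,
    λ { zero g    → trans (cong (χ zero) (sym (assoc C f₀ f₁ g))) (e₀ _)
      ; (suc i) g → trans (cong (χ (suc i)) (sym (assoc C f₀ f₁ g))) (e₁ i g) }

module _ (C : FinCat) where

  -- An increasing choice of positions with a morphism into each chosen object. If sequences are
  -- read as the children of a root, these are the embeddings of trees with one more level.
  Sub : List (Obj C) → List (Obj C) → Set
  Sub = Sublist (Hom C)

  sub-id : ∀ As → Sub As As
  sub-id []       = []
  sub-id (A ∷ As) = idᶜ C A ∷ sub-id As

  sub-comp : ∀ {As Bs Cs} → Sub Bs Cs → Sub As Bs → Sub As Cs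
  sub-comp []       []       = []
  sub-comp (y ∷ʳ g) f        = y ∷ʳ sub-comp g f
  sub-comp (h ∷ g)  (y ∷ʳ f) = _ ∷ʳ sub-comp g f
  sub-comp (h ∷ g)  (k ∷ f)  = comp C h k ∷ sub-comp g f

  sub-assoc : ∀ {As Bs Cs Ds} (h : Sub Cs Ds) (g : Sub Bs Cs) (f : Sub As Bs) →
              sub-comp h (sub-comp g f) ≡ sub-comp (sub-comp h g) f
  sub-assoc []       []       []       = refl
  sub-assoc (y ∷ʳ h) g        f        = cong (y ∷ʳ_) (sub-assoc h g f)
  sub-assoc (a ∷ h)  (y ∷ʳ g) f        = cong (_ ∷ʳ_) (sub-assoc h g f)
  sub-assoc (a ∷ h)  (b ∷ g)  (y ∷ʳ f) = cong (_ ∷ʳ_) (sub-assoc h g f)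
  sub-assoc (a ∷ h)  (b ∷ g)  (c ∷ f)  = cong₂ _∷_ (assoc C a b c) (sub-assoc h g f)

  subs : ∀ As Bs → List (Sub As Bs)
  subs []       []       = [ [] ]
  subs (A ∷ As) []       = []
  subs []       (B ∷ Bs) = List.map (B ∷ʳ_) (subs [] Bs)
  subs (A ∷ As) (B ∷ Bs) =
    List.map (B ∷ʳ_) (subs (A ∷ As) Bs) ++ cartesianProductWith _∷_ (homs C A B) (subs As Bs)

  subs-complete : ∀ {As Bs} (f : Sub As Bs) → f ∈ subs As Bs
  subs-complete {[]}     []       = here refl
  subs-complete {[]}     (y ∷ʳ f) = ∈-map⁺ (y ∷ʳ_) (subs-complete f)
  subs-complete {A ∷ As} (y ∷ʳ f) = ∈-++⁺ˡ (∈-map⁺ (y ∷ʳ_) (subs-complete f))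
  subs-complete {A ∷ As} {B ∷ Bs} (a ∷ f) =
    ∈-++⁺ʳ (List.map (B ∷ʳ_) (subs (A ∷ As) Bs))
           (∈-cartesianProductWith⁺ _∷_ (homs-complete C a) (subs-complete f))

  sub-min : ∀ Bs → Sub [] Bs
  sub-min []       = []
  sub-min (B ∷ Bs) = B ∷ʳ sub-min Bs

  sub-min-unique : ∀ {Bs} (f g : Sub [] Bs) → f ≡ g
  sub-min-unique []       []       = refl
  sub-min-unique (y ∷ʳ f) (y ∷ʳ g) = cong (y ∷ʳ_) (sub-min-unique f g)

  sub-++ˡ : ∀ As Bs → Sub As (As ++ Bs)
  sub-++ˡ []       Bs = sub-min Bs
  sub-++ˡ (A ∷ As) Bs = idᶜ C A ∷ sub-++ˡ As Bs

  sub-++ʳ : ∀ {As} Bs {Cs} → Sub As Cs → Sub As (Bs ++ Cs)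
  sub-++ʳ []       f = f
  sub-++ʳ (B ∷ Bs) f = B ∷ʳ sub-++ʳ Bs f

  sub-concat : ∀ Bss → All (λ Bs → Sub Bs (concat Bss)) Bss
  sub-concat []         = []
  sub-concat (Bs ∷ Bss) = sub-++ˡ Bs (concat Bss) ∷ All.map (sub-++ʳ Bs) (sub-concat Bss)

  Fam : FinCat
  Fam = record
    { Obj = List (Obj C) ; Hom = Sub ; idᶜ = sub-id ; comp = sub-comp ; assoc = sub-assoc
    ; homs = subs ; homs-complete = subs-complete ; join = concat ; join-inj = sub-concat }

  replicate-emb : ∀ {J} {Bs} → All (λ B → Hom C B J) Bs → ∀ {q} → length Bs ≤ q → Sub Bs (replicate q J)
  replicate-emb []       {q}     _         = sub-min _
  replicate-emb (b ∷ bs) {suc q} (s≤s m≤q) = b ∷ replicate-emb bs m≤q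

total : ∀ {k} → (Fin k → ℕ) → ℕ
total {zero}  q = 0
total {suc k} q = q zero + total (q ∘ suc)

total-updateAt : ∀ {k} (q : Fin k → ℕ) c → total (updateAt q c suc) ≡ suc (total q)
total-updateAt q zero    = refl
total-updateAt q (suc c) =
  trans (cong (q zero +_) (total-updateAt (q ∘ suc) c)) (ℕₚ.+-suc (q zero) _)

total-zero : ∀ k → total {k} (λ _ → 0) ≡ 0
total-zero zero    = refl
total-zero (suc k) = total-zero k

-- Pigeonhole by induction on the classes: if the first has fewer than `m`, the others still have
-- `m` each on average.
total-large : ∀ {k} (q : Fin (suc k) → ℕ) m → suc k * m ≤ total q → ∃ λ c → m ≤ q c
total-large {k} q m le with m ℕₚ.≤? q zero
... | yes p = zero , p
total-large {zero} q m le | no ¬p =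
  contradiction (subst (_≤ q zero) (ℕₚ.+-identityʳ m) (subst (m + 0 ≤_) (ℕₚ.+-identityʳ (q zero)) le)) ¬p
total-large {suc k} q m le | no ¬p
  with c , p ← total-large (q ∘ suc) m
         (ℕₚ.+-cancelˡ-≤ m _ _ (ℕₚ.≤-trans le (ℕₚ.+-monoˡ-≤ (total (q ∘ suc)) (ℕₚ.<⇒≤ (ℕₚ.≰⇒> ¬p)))))
  = suc c , p

module _ (C : FinCat) (A : Obj C) (R : Ramsey C A) (As : List (Obj C)) (k : ℕ) where

  -- The colour of an embedding depends only on the member of Bs that receives the first object A.
  HeadDetermined : ∀ Bs → (Sub C (A ∷ As) Bs → Fin (suc k)) → Set
  HeadDetermined []       χ = ⊤
  HeadDetermined (B ∷ Bs) χ =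
    (∃ λ c → ∀ a g → χ (a ∷ g) ≡ c) × HeadDetermined Bs (χ ∘ (B ∷ʳ_))

  headDetermined-cong : ∀ Bs {χ χ′} → (∀ g → χ g ≡ χ′ g) → HeadDetermined Bs χ → HeadDetermined Bs χ′
  headDetermined-cong []       eq _             = tt
  headDetermined-cong (B ∷ Bs) eq ((c , p) , h) =
    (c , λ a g → trans (sym (eq _)) (p a g)) , headDetermined-cong Bs (λ g → eq _) h

  module _ (RAs : ∀ Bs q → Σ (List (Obj C)) λ Zs →
              (χ : Fin q → Sub C As Zs → Fin (suc k)) →
              Σ (Sub C Bs Zs) λ f → Σ (Fin q → Fin (suc k)) λ c → ∀ i g → χ i (sub-comp C f g) ≡ c i) where

    -- Colouring the pairs (image of A, image of As) by the image of As alone, once for each of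
    -- the finitely many embeddings of A into B₀, reduces to RAs and then to R.
    headDetermined-exists : ∀ Bs → Σ (List (Obj C)) λ Zs → (χ : Sub C (A ∷ As) Zs → Fin (suc k)) →
      Σ (Sub C Bs Zs) λ f → HeadDetermined Bs (χ ∘ sub-comp C f)
    headDetermined-exists []       = [] , λ χ → [] , tt
    headDetermined-exists (B ∷ Bs)
      with Zs , P ← headDetermined-exists Bs
      with B₀ , P₀ ← R B k
      with W , P₁ ← RAs Zs (length (homs C A B₀)) = B₀ ∷ W , go
      where
      go : (χ : Sub C (A ∷ As) (B₀ ∷ W) → Fin (suc k)) →
           Σ (Sub C (B ∷ Bs) (B₀ ∷ W)) λ f → HeadDetermined (B ∷ Bs) (χ ∘ sub-comp C f)
      go χ
        with f₁ , c₁ , e₁ ← P₁ (λ i g → χ (List.lookup (homs C A B₀) i ∷ g))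
        -- The colour now depends on the image of `A` alone, so it colours the morphisms from `A` to
        -- `B₀`, to which the Ramsey property of `A` applies.
        with f₀ , c₀ , e₀ ← P₀ (λ a → c₁ (Any.index (homs-complete C a)))
        -- Embeddings that skip `B₀` have their head in `W`; the recursion on `Bs` handles them
        -- inside the copy of `Zs` just found in `W`.
        with f₂ , h₂ ← P (λ g → χ (B₀ ∷ʳ sub-comp C f₁ g)) =
        (f₀ ∷ sub-comp C f₁ f₂) ,
        (c₀ , λ a g →
          trans (cong₂ (λ x y → χ (x ∷ y)) (lookup-index (homs-complete C (comp C f₀ a)))
                       (sym (sub-assoc C f₁ f₂ g)))
                (trans (e₁ (Any.index (homs-complete C (comp C f₀ a))) (sub-comp C f₂ g)) (e₀ a))) ,
        headDetermined-cong Bs (λ g → cong (χ ∘ (B₀ ∷ʳ_)) (sub-assoc C f₁ f₂ g)) h₂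

  -- Each position of the constant sequence has a colour, that of the embeddings whose head lands
  -- there. The positions of colour `c` form a constant sequence of length `q c`, and an embedding
  -- into it has its head at one of them.
  headDetermined-split : ∀ J M (χ : Sub C (A ∷ As) (replicate M J) → Fin (suc k)) →
    HeadDetermined (replicate M J) χ → Σ (Fin (suc k) → ℕ) λ q → total q ≡ M ×
    (∀ c → Σ (Sub C (replicate (q c) J) (replicate M J)) λ f → ∀ g → χ (sub-comp C f g) ≡ c)
  headDetermined-split J zero    χ _ = (λ _ → 0) , total-zero (suc k) , λ c → [] , λ ()
  headDetermined-split J (suc M) χ ((c₀ , p) , h)
    with q , s , P ← headDetermined-split J M (χ ∘ (J ∷ʳ_)) h =
    updateAt q c₀ suc , trans (total-updateAt q c₀) (cong suc s) , go
    where
    go : ∀ c → Σ (Sub C (replicate (updateAt q c₀ suc c) J) (replicate (suc M) J)) λ f →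
         ∀ g → χ (sub-comp C f g) ≡ c
    go c with c Finₚ.≟ c₀
    ... | no c≢c₀ rewrite updateAt-minimal c c₀ {f = suc} q c≢c₀ =
      (J ∷ʳ proj₁ (P c)) , proj₂ (P c)
    ... | yes refl rewrite updateAt-updates c {f = suc} q =
      (idᶜ C J ∷ proj₁ (P c)) , λ { (y ∷ʳ g) → proj₂ (P c) g ; (a ∷ g) → p _ _ }

fam-ramsey : ∀ C → (∀ A → Ramsey C A) → ∀ As → Ramsey (Fam C) As
fam-ramsey C R []       Bs k = Bs , λ χ →
  sub-id C Bs , χ (sub-min C Bs) , λ g → cong χ (sub-min-unique C _ _)
fam-ramsey C R (A ∷ As) Bs k
  with Zs , P ← headDetermined-exists C A (R A) As k
         (λ Cs q → ramsey-multi (Fam C) q (λ _ → As) (λ _ → fam-ramsey C R As) Cs k)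
         -- Among `suc k * length Bs` positions some colour occurs at least `length Bs` times, which
         -- is enough for `replicate-emb`.
         (replicate (suc k * length Bs) (join C Bs)) = Zs , go
  where
  go : (χ : Sub C (A ∷ As) Zs → Fin (suc k)) →
       Σ (Sub C Bs Zs) λ f → ∃ λ c → ∀ g → χ (sub-comp C f g) ≡ c
  go χ
    with f , h ← P χ
    with q , s , Q ← headDetermined-split C A (R A) As k (join C Bs) (suc k * length Bs) _ h
    with c , m≤ ← total-large q (length Bs) (ℕₚ.≤-reflexive (sym s))
    with e ← replicate-emb C (join-inj C Bs) m≤
    with f′ , p ← Q c =
    sub-comp C f (sub-comp C f′ e) , c , λ g →
      trans (cong χ (trans (sym (sub-assoc C f (sub-comp C f′ e) g))
                           (cong (sub-comp C f) (sym (sub-assoc C f′ e g)))))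
            (p (sub-comp C e g))

Point : FinCat
Point = record
  { Obj = ⊤ ; Hom = λ _ _ → ⊤ ; idᶜ = λ _ → tt ; comp = λ _ _ → tt ; assoc = λ _ _ _ → refl
  ; homs = λ _ _ → [ tt ] ; homs-complete = λ _ → here refl ; join = λ _ → tt
  ; join-inj = λ Bs → All.universal (λ _ → tt) Bs }

Trees : ℕ → FinCat
Trees zero    = Point
Trees (suc n) = Fam (Trees n)

trees-ramsey : ∀ n A → Ramsey (Trees n) A
trees-ramsey zero    A B k = tt , λ χ → tt , χ tt , λ _ → refl
trees-ramsey (suc n) = fam-ramsey (Trees n) (trees-ramsey n)

-- Leaves of trees as ordered ultrametric spaces.

-- Distances are levels up to `n`. The bound `m` in `dist-ultra` stands for the maximum: being at
-- distance at most `m` is an equivalence relation, whose classes are the balls.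
record Ultra (P : Set) (n : ℕ) : Set where
  field
    dist       : P → P → ℕ
    dist-refl  : ∀ x → dist x x ≡ 0
    dist-zero  : ∀ {x y} → dist x y ≡ 0 → x ≡ y
    dist-sym   : ∀ x y → dist x y ≡ dist y x
    dist-ultra : ∀ x y z {m} → dist x y ≤ m → dist y z ≤ m → dist x z ≤ m
    dist-≤     : ∀ x y → dist x y ≤ n

open Ultra

pullback : ∀ {P Q n} → Ultra P n → (g : Q → P) → (∀ {x y} → g x ≡ g y → x ≡ y) → Ultra Q n
pullback U g inj = record
  { dist = λ x y → dist U (g x) (g y) ; dist-refl = λ x → dist-refl U (g x)
  ; dist-zero = λ e → inj (dist-zero U e) ; dist-sym = λ x y → dist-sym U (g x) (g y)
  ; dist-ultra = λ x y z → dist-ultra U (g x) (g y) (g z) ; dist-≤ = λ x y → dist-≤ U (g x) (g y) }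

Isometric : ∀ {P Q m n} → Ultra P m → Ultra Q n → (P → Q) → Set
Isometric U V f = ∀ x y → dist V (f x) (f y) ≡ dist U x y

isometric-injective : ∀ {P Q m n} (U : Ultra P m) (V : Ultra Q n) {f} → Isometric U V f →
                      ∀ {x y} → f x ≡ f y → x ≡ y
isometric-injective U V {f} iso {x} {y} e =
  dist-zero U (trans (sym (iso x y)) (trans (cong (dist V (f x)) (sym e)) (dist-refl V (f x))))

-- Every ball is an interval, as one sees by taking an endpoint of the interval as its centre.
Convex : ∀ {P n} → Ultra P n → (P → P → Set) → Set
Convex U _≺_ = ∀ x y z → x ≺ y → y ≺ z → dist U x y ≤ dist U x z

Tree : ℕ → Set
Tree n = Obj (Trees n)

Leaf : ∀ n → Tree n → Set
Leaf zero    _  = ⊤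
Leaf (suc n) ts = Any (Leaf n) ts

-- The height of the lowest common ancestor.
δ : ∀ n {t} → Leaf n t → Leaf n t → ℕ
δ zero    _         _         = 0
δ (suc n) (here x)  (here y)  = δ n x y
δ (suc n) (here x)  (there y) = suc n
δ (suc n) (there x) (here y)  = suc n
δ (suc n) (there x) (there y) = δ (suc n) x y

δ-refl : ∀ n {t} (x : Leaf n t) → δ n x x ≡ 0
δ-refl zero    x         = refl
δ-refl (suc n) (here x)  = δ-refl n x
δ-refl (suc n) (there x) = δ-refl (suc n) x

δ-zero : ∀ n {t} {x y : Leaf n t} → δ n x y ≡ 0 → x ≡ y
δ-zero zero    e = refl
δ-zero (suc n) {x = here x}  {here y}  e = cong here (δ-zero n e)
δ-zero (suc n) {x = there x} {there y} e = cong there (δ-zero (suc n) e)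

δ-sym : ∀ n {t} (x y : Leaf n t) → δ n x y ≡ δ n y x
δ-sym zero    x         y         = refl
δ-sym (suc n) (here x)  (here y)  = δ-sym n x y
δ-sym (suc n) (here x)  (there y) = refl
δ-sym (suc n) (there x) (here y)  = refl
δ-sym (suc n) (there x) (there y) = δ-sym (suc n) x y

δ-≤ : ∀ n {t} (x y : Leaf n t) → δ n x y ≤ n
δ-≤ zero    x         y         = z≤n
δ-≤ (suc n) (here x)  (here y)  = ℕₚ.m≤n⇒m≤1+n (δ-≤ n x y)
δ-≤ (suc n) (here x)  (there y) = ℕₚ.≤-refl
δ-≤ (suc n) (there x) (here y)  = ℕₚ.≤-refl
δ-≤ (suc n) (there x) (there y) = δ-≤ (suc n) x y

δ-ultra : ∀ n {t} (x y z : Leaf n t) {m} → δ n x y ≤ m → δ n y z ≤ m → δ n x z ≤ m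
δ-ultra zero    x         y         z         p q = p
δ-ultra (suc n) (here x)  (here y)  (here z)  p q = δ-ultra n x y z p q
δ-ultra (suc n) (here x)  (here y)  (there z) p q = q
δ-ultra (suc n) (here x)  (there y) (here z)  p q = ℕₚ.≤-trans (ℕₚ.m≤n⇒m≤1+n (δ-≤ n x z)) p
δ-ultra (suc n) (here x)  (there y) (there z) p q = p
δ-ultra (suc n) (there x) (here y)  (here z)  p q = p
δ-ultra (suc n) (there x) (here y)  (there z) p q = ℕₚ.≤-trans (δ-≤ (suc n) x z) p
δ-ultra (suc n) (there x) (there y) (here z)  p q = q
δ-ultra (suc n) (there x) (there y) (there z) p q = δ-ultra (suc n) x y z p q

leafUltra : ∀ n t → Ultra (Leaf n t) n
leafUltra n t = record
  { dist = δ n ; dist-refl = δ-refl n ; dist-zero = δ-zero n ; dist-sym = δ-sym n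
  ; dist-ultra = δ-ultra n ; dist-≤ = δ-≤ n }

lt : ∀ n {t} → Leaf n t → Leaf n t → Set
lt zero    _         _         = ⊥
lt (suc n) (here x)  (here y)  = lt n x y
lt (suc n) (here x)  (there y) = ⊤
lt (suc n) (there x) (here y)  = ⊥
lt (suc n) (there x) (there y) = lt (suc n) x y

lt-trans : ∀ n {t} (x y z : Leaf n t) → lt n x y → lt n y z → lt n x z
lt-trans (suc n) (here x)  (here y)  (here z)  p q = lt-trans n x y z p q
lt-trans (suc n) (here x)  (here y)  (there z) p q = tt
lt-trans (suc n) (here x)  (there y) (there z) p q = tt
lt-trans (suc n) (there x) (there y) (there z) p q = lt-trans (suc n) x y z p q

lt-irrefl : ∀ n {t} (x : Leaf n t) → ¬ lt n x x
lt-irrefl (suc n) (here x)  p = lt-irrefl n x p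
lt-irrefl (suc n) (there x) p = lt-irrefl (suc n) x p

lt-connex : ∀ n {t} (x y : Leaf n t) → lt n x y ⊎ x ≡ y ⊎ lt n y x
lt-connex zero    x         y         = inj₂ (inj₁ refl)
lt-connex (suc n) (here x)  (there y) = inj₁ tt
lt-connex (suc n) (there x) (here y)  = inj₂ (inj₂ tt)
lt-connex (suc n) (here x)  (here y) with lt-connex n x y
... | inj₁ p        = inj₁ p
... | inj₂ (inj₁ e) = inj₂ (inj₁ (cong here e))
... | inj₂ (inj₂ p) = inj₂ (inj₂ p)
lt-connex (suc n) (there x) (there y) with lt-connex (suc n) x y
... | inj₁ p        = inj₁ p
... | inj₂ (inj₁ e) = inj₂ (inj₁ (cong there e))
... | inj₂ (inj₂ p) = inj₂ (inj₂ p)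

lt-convex : ∀ n {t} (x y z : Leaf n t) → lt n x y → lt n y z → δ n x y ≤ δ n x z
lt-convex (suc n) (here x)  (here y)  (here z)  p q = lt-convex n x y z p q
lt-convex (suc n) (here x)  (here y)  (there z) p q = ℕₚ.m≤n⇒m≤1+n (δ-≤ n x y)
lt-convex (suc n) (here x)  (there y) (there z) p q = ℕₚ.≤-refl
lt-convex (suc n) (there x) (there y) (there z) p q = lt-convex (suc n) x y z p q

leaf-card : ∀ n t → ∃ λ N → Fin N ↔ Leaf n t
leaf-card zero    t        = 1 , Finₚ.1↔⊤
leaf-card (suc n) []       = 0 , (⊥↔Any[] ↔-∘ Finₚ.0↔⊥)
leaf-card (suc n) (t ∷ ts) with a , f ← leaf-card n t | b , g ← leaf-card (suc n) ts =
  a + b , (∷↔ (Leaf n) ↔-∘ ((f ⊎-↔ g) ↔-∘ Finₚ.+↔⊎))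

-- Embeddings of trees and the maps of leaves that they induce.

app : ∀ n {A B} → Hom (Trees n) A B → Leaf n A → Leaf n B
app zero    e        x         = tt
app (suc n) (y ∷ʳ e) x         = there (app (suc n) e x)
app (suc n) (h ∷ e)  (here x)  = here (app n h x)
app (suc n) (h ∷ e)  (there x) = there (app (suc n) e x)

app-comp : ∀ n {A B C} (f : Hom (Trees n) B C) (g : Hom (Trees n) A B) x →
           app n (comp (Trees n) f g) x ≡ app n f (app n g x)
app-comp zero    f        g        x         = refl
app-comp (suc n) []       []       ()
app-comp (suc n) (y ∷ʳ f) g        x         = cong there (app-comp (suc n) f g x)
app-comp (suc n) (h ∷ f)  (y ∷ʳ g) x         = cong there (app-comp (suc n) f g x)
app-comp (suc n) (h ∷ f)  (k ∷ g)  (here x)  = cong here (app-comp n h k x)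
app-comp (suc n) (h ∷ f)  (k ∷ g)  (there x) = cong there (app-comp (suc n) f g x)

app-isometric : ∀ n {A B} (e : Hom (Trees n) A B) → Isometric (leafUltra n A) (leafUltra n B) (app n e)
app-isometric zero    e        x         y         = refl
app-isometric (suc n) (_ ∷ʳ e) x         y         = app-isometric (suc n) e x y
app-isometric (suc n) (h ∷ e)  (here x)  (here y)  = app-isometric n h x y
app-isometric (suc n) (h ∷ e)  (here x)  (there y) = refl
app-isometric (suc n) (h ∷ e)  (there x) (here y)  = refl
app-isometric (suc n) (h ∷ e)  (there x) (there y) = app-isometric (suc n) e x y

-- A vertex without leaves below it leaves no trace in the leaf space, so a map of leaves could not
-- say where to send it.
Inhabited : ∀ n → Tree n → Set
Inhabited zero    _  = ⊤
Inhabited (suc n) ts = 1 ≤ length ts × All (Inhabited n) ts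

first : ∀ n {t} → Inhabited n t → Leaf n t
first zero            _            = tt
first (suc n) {t ∷ _} (_ , i ∷ is) = here (first n i)

is-here : ∀ n {t ts} {x : Leaf n t} (z : Leaf (suc n) (t ∷ ts)) → δ (suc n) (here x) z ≤ n →
          ∃ λ z′ → z ≡ here z′
is-here n (here z)  p = z , refl
is-here n (there z) p = contradiction p (ℕₚ.n≮n n)

is-there : ∀ n {t ts} {x : Leaf n t} (z : Leaf (suc n) (t ∷ ts)) → δ (suc n) {t ∷ ts} (here x) z ≡ suc n →
           ∃ λ z′ → z ≡ there z′
is-there n {x = x} (here z) p = contradiction (subst (_≤ n) p (δ-≤ n x z)) (ℕₚ.n≮n n)
is-there n (there z)        p = z , refl

is-there-close : ∀ n {t ts} {x : Leaf (suc n) ts} (z : Leaf (suc n) (t ∷ ts)) →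
                 δ (suc n) (there x) z ≤ n → ∃ λ z′ → z ≡ there z′
is-there-close n (here z)  p = contradiction p (ℕₚ.n≮n n)
is-there-close n (there z) p = z , refl

is-there-after : ∀ n {t ts} {x : Leaf (suc n) ts} (z : Leaf (suc n) (t ∷ ts)) →
                 lt (suc n) (there x) z → ∃ λ z′ → z ≡ there z′
is-there-after n (there z) p = z , refl

Increasing : ∀ {P Q : Set} → (P → P → Set) → (Q → Q → Set) → (P → Q) → Set
Increasing _≺_ _⊏_ f = ∀ x y → x ≺ y → f x ⊏ f y

-- The image of the first leaf decides how to treat the first child of the target. If it lies there,
-- distances force the whole first child of the source to follow and all later ones, `suc n` away,
-- to stay outside. If it lies further on, nothing may enter that child: the leaves near the first
-- one stay near its image, and the later ones come after it.
induced : ∀ n A B → Inhabited n A → (h : Leaf n A → Leaf n B) →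
          Isometric (leafUltra n A) (leafUltra n B) h → Increasing (lt n) (lt n) h →
          Σ (Hom (Trees n) A B) λ e → ∀ x → app n e x ≡ h x
induced zero    A B i h iso inc = tt , λ _ → refl
induced (suc n) A B (_ , i) = go A B i
  where
  go : ∀ As Bs → All (Inhabited n) As → (h : Leaf (suc n) As → Leaf (suc n) Bs) →
       Isometric (leafUltra (suc n) As) (leafUltra (suc n) Bs) h → Increasing (lt (suc n)) (lt (suc n)) h →
       Σ (Hom (Trees (suc n)) As Bs) λ e → ∀ x → app (suc n) e x ≡ h x
  go []       Bs       _        h iso inc = sub-min (Trees n) Bs , λ ()
  go (A ∷ As) []       (i ∷ is) h iso inc with () ← h (here (first n i))
  go (A ∷ As) (B ∷ Bs) (i ∷ is) h iso inc with h (here (first n i)) in eq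
  ... | here b = (proj₁ eA ∷ proj₁ eAs) ,
                 λ { (here x)  → trans (cong here (proj₂ eA x)) (sym (proj₂ (hA x)))
                   ; (there y) → trans (cong there (proj₂ eAs y)) (sym (proj₂ (hAs y))) }
    where
    hA : ∀ x → ∃ λ z → h (here x) ≡ here z
    hA x = is-here n (h (here x)) (subst (_≤ n) (sym (trans (cong (λ w → δ (suc n) w (h (here x))) (sym eq))
                                   (iso (here (first n i)) (here x)))) (δ-≤ n (first n i) x))
    hAs : ∀ y → ∃ λ z → h (there y) ≡ there z
    hAs y = is-there n (h (there y)) (trans (cong (λ w → δ (suc n) w (h (there y))) (sym eq))
                                            (iso (here (first n i)) (there y)))
    eA : Σ (Hom (Trees n) A B) λ e → ∀ x → app n e x ≡ proj₁ (hA x)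
    eA = induced n A B i (proj₁ ∘ hA)
      (λ x y → trans (cong₂ (δ (suc n)) (sym (proj₂ (hA x))) (sym (proj₂ (hA y)))) (iso (here x) (here y)))
      (λ x y p → subst₂ (lt (suc n)) (proj₂ (hA x)) (proj₂ (hA y)) (inc (here x) (here y) p))
    eAs : Σ (Hom (Trees (suc n)) As Bs) λ e → ∀ x → app (suc n) e x ≡ proj₁ (hAs x)
    eAs = go As Bs is (proj₁ ∘ hAs)
      (λ x y → trans (cong₂ (δ (suc n)) (sym (proj₂ (hAs x))) (sym (proj₂ (hAs y)))) (iso (there x) (there y)))
      (λ x y p → subst₂ (lt (suc n)) (proj₂ (hAs x)) (proj₂ (hAs y)) (inc (there x) (there y) p))
  ... | there b = (B ∷ʳ proj₁ e) , λ x → trans (cong there (proj₂ e x)) (sym (proj₂ (h′ x)))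
    where
    h′ : ∀ x → ∃ λ z → h x ≡ there z
    h′ (here x)  = is-there-close n (h (here x))
      (subst (_≤ n) (sym (trans (cong (λ w → δ (suc n) w (h (here x))) (sym eq))
                                (iso (here (first n i)) (here x)))) (δ-≤ n (first n i) x))
    h′ (there y) = is-there-after n (h (there y))
      (subst (λ w → lt (suc n) w (h (there y))) eq (inc (here (first n i)) (there y) tt))
    e : Σ (Hom (Trees (suc n)) (A ∷ As) Bs) λ e → ∀ x → app (suc n) e x ≡ proj₁ (h′ x)
    e = go (A ∷ As) Bs (i ∷ is) (proj₁ ∘ h′)
      (λ x y → trans (cong₂ (δ (suc n)) (sym (proj₂ (h′ x))) (sym (proj₂ (h′ y)))) (iso x y))
      (λ x y p → subst₂ (lt (suc n)) (proj₂ (h′ x)) (proj₂ (h′ y)) (inc x y p))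

-- Convexly ordered spaces as leaf spaces of trees.

path : ∀ n → Tree n
path zero    = tt
path (suc n) = path n ∷ []

path-inhabited : ∀ n → Inhabited n (path n)
path-inhabited zero    = tt
path-inhabited (suc n) = s≤s z≤n , path-inhabited n ∷ []

path-δ : ∀ n (x y : Leaf n (path n)) → δ n x y ≡ 0
path-δ zero    x        y        = refl
path-δ (suc n) (here x) (here y) = path-δ n x y

path-lt : ∀ n (x y : Leaf n (path n)) → ¬ lt n x y
path-lt (suc n) (here x) (here y) p = path-lt n x y p

-- `label` may miss points of `P`, so that a tree can be built up one point at a time.
record Rep {P : Set} {m} (U : Ultra P m) (_≺_ : P → P → Set) (n : ℕ) : Set where
  field
    tree       : Tree n
    inhabited  : Inhabited n tree
    label      : Leaf n tree → P
    isometric  : Isometric (leafUltra n tree) U label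
    increasing : Increasing (lt n) _≺_ label

open Rep

pathRep : ∀ {P m} (U : Ultra P m) (_≺_ : P → P → Set) n → P → Rep U _≺_ n
pathRep U _≺_ n z = record
  { tree = path n ; inhabited = path-inhabited n ; label = λ _ → z
  ; isometric = λ x y → trans (dist-refl U z) (sym (path-δ n x y))
  ; increasing = λ x y p → ⊥-elim (path-lt n x y p) }

-- By convexity only the first child can be close to a new point that precedes all others: the point
-- enters that child, or else becomes a new first child.
insert : ∀ {P m} (U : Ultra P m) (_≺_ : P → P → Set) n (T : Rep U _≺_ n) z →
  (∀ x → 1 ≤ dist U z (label T x)) → (∀ x → dist U z (label T x) ≤ n) → (∀ x → z ≺ label T x) →
  (∀ x y → lt n x y → dist U z (label T x) ≤ dist U z (label T y)) →
  Σ (Rep U _≺_ n) λ T′ → (∃ λ x′ → label T′ x′ ≡ z) × (∀ x → ∃ λ x′ → label T′ x′ ≡ label T x) ×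
    (∀ x′ → label T′ x′ ≡ z ⊎ ∃ λ x → label T′ x′ ≡ label T x)
insert U _≺_ zero T z pos bnd lo con =
  contradiction (ℕₚ.≤-trans (pos (first 0 (inhabited T))) (bnd (first 0 (inhabited T)))) λ ()
insert U _≺_ (suc n) T z pos bnd lo con with tree T | inhabited T | label T | isometric T | increasing T
... | t ∷ ts | (_ , i ∷ is) | l | iso | inc
  with dist U z (l (here (first n i))) ℕₚ.≤? n
... | yes close = T′ , (here (proj₁ new) , proj₂ new) ,
    (λ { (here x) → here (proj₁ (old x)) , proj₂ (old x) ; (there y) → there y , refl }) ,
    λ { (here x) → fromBlock (origin x) ; (there y) → inj₂ (there y , refl) }
  where
  x₀ : Leaf n t
  x₀ = first n i
  T₁ : Rep U _≺_ n
  T₁ = record { tree = t ; inhabited = i ; label = l ∘ here ; isometric = λ x y → iso (here x) (here y)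
              ; increasing = λ x y → inc (here x) (here y) }
  blk : ∀ x → dist U (l (here x₀)) (l (here x)) ≤ n
  blk x = subst (_≤ n) (sym (iso (here x₀) (here x))) (δ-≤ n x₀ x)
  rec : Σ (Rep U _≺_ n) λ T′ → (∃ λ x′ → label T′ x′ ≡ z) × (∀ x → ∃ λ x′ → label T′ x′ ≡ l (here x)) ×
    (∀ x′ → label T′ x′ ≡ z ⊎ ∃ λ x → label T′ x′ ≡ l (here x))
  rec = insert U _≺_ n T₁ z (pos ∘ here) (λ x → dist-ultra U _ _ _ close (blk x)) (lo ∘ here)
               (λ x y → con (here x) (here y))
  T₂ = proj₁ rec
  new = proj₁ (proj₂ rec)
  old = proj₁ (proj₂ (proj₂ rec))
  -- Every label of the enlarged child is `z` or an old one; this settles its distance and order to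
  -- the other children.
  origin = proj₂ (proj₂ (proj₂ rec))
  fromBlock : ∀ {w} → w ≡ z ⊎ (∃ λ x → w ≡ l (here x)) → w ≡ z ⊎ (∃ λ x → w ≡ l x)
  fromBlock (inj₁ e)       = inj₁ e
  fromBlock (inj₂ (x , e)) = inj₂ (here x , e)
  -- Were `z` within `n` of a later child as well, that child would be within `n` of the first one.
  zfar : ∀ y → dist U z (l (there y)) ≡ suc n
  zfar y = ℕₚ.≤-antisym (bnd (there y)) (ℕₚ.≰⇒> λ p → ℕₚ.n≮n n (subst (_≤ n) (iso (here x₀) (there y))
    (dist-ultra U (l (here x₀)) z (l (there y)) (subst (_≤ n) (dist-sym U z (l (here x₀))) close) p)))
  far : ∀ x y → dist U (label T₂ x) (l (there y)) ≡ suc n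
  far x y with origin x
  ... | inj₁ e        = trans (cong (λ w → dist U w (l (there y))) e) (zfar y)
  ... | inj₂ (x′ , e) = trans (cong (λ w → dist U w (l (there y))) e) (iso (here x′) (there y))
  before : ∀ x y → label T₂ x ≺ l (there y)
  before x y with origin x
  ... | inj₁ e        = subst (_≺ l (there y)) (sym e) (lo (there y))
  ... | inj₂ (x′ , e) = subst (_≺ l (there y)) (sym e) (inc (here x′) (there y) tt)
  l′ : Leaf (suc n) (tree T₂ ∷ ts) → _
  l′ (here x)  = label T₂ x
  l′ (there y) = l (there y)
  T′ : Rep U _≺_ (suc n)
  T′ = record
    { tree = tree T₂ ∷ ts ; inhabited = s≤s z≤n , inhabited T₂ ∷ is ; label = l′
    ; isometric = λ { (here x)  (here y)  → isometric T₂ x y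
                    ; (here x)  (there y) → far x y
                    ; (there x) (here y)  → trans (dist-sym U (l (there x)) (label T₂ y)) (far y x)
                    ; (there x) (there y) → iso (there x) (there y) }
    ; increasing = λ { (here x)  (here y)  p → increasing T₂ x y p
                     ; (here x)  (there y) p → before x y
                     ; (there x) (there y) p → inc (there x) (there y) p } }
... | no ¬close = T′ , (here (first n (path-inhabited n)) , refl) , (λ x → there x , refl) ,
    λ { (here x) → inj₁ refl ; (there y) → inj₂ (y , refl) }
  where
  x₀ : Leaf n t
  x₀ = first n i
  far : ∀ y → suc n ≤ dist U z (l y)
  far (here x)  = ℕₚ.≰⇒> λ p → ¬close (dist-ultra U _ _ _ p
    (subst (_≤ n) (sym (iso (here x) (here x₀))) (δ-≤ n x x₀)))
  -- No later child is nearer to `z` than the first, because distances from `z` do not decrease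
  -- along the order.
  far (there y) = ℕₚ.≤-trans (ℕₚ.≰⇒> ¬close) (con (here x₀) (there y) tt)
  far≡ : ∀ y → dist U z (l y) ≡ suc n
  far≡ y = ℕₚ.≤-antisym (bnd y) (far y)
  l′ : Leaf (suc n) (path n ∷ t ∷ ts) → _
  l′ (here x)  = z
  l′ (there y) = l y
  T′ : Rep U _≺_ (suc n)
  T′ = record
    { tree = path n ∷ t ∷ ts ; inhabited = s≤s z≤n , path-inhabited n ∷ i ∷ is ; label = l′
    ; isometric = λ { (here x)  (here y)  → trans (dist-refl U z) (sym (path-δ n x y))
                    ; (here x)  (there y) → far≡ y
                    ; (there x) (here y)  → trans (dist-sym U (l x) z) (far≡ x)
                    ; (there x) (there y) → iso x y }
    ; increasing = λ { (here x)  (here y)  p → ⊥-elim (path-lt n x y p)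
                     ; (here x)  (there y) p → lo y
                     ; (there x) (there y) p → inc x y p } }

-- Points are added from the last to the first, so that each new one is least; convexity then says
-- that distances from it do not decrease along the order, as `insert` asks. Since an inhabited tree
-- has a leaf, the construction starts from a single point.
represent : ∀ {N n} → 1 ≤ N → (U : Ultra (Fin N) n) → Convex U F._<_ →
            Σ (Rep U F._<_ n) λ T → ∀ x → ∃ λ y → label T y ≡ x
represent {suc zero}    {n} _ U con = pathRep U F._<_ n zero , λ { zero → first n (path-inhabited n) , refl }
represent {suc (suc p)} {n} _ U con
  with T , sur ← represent (s≤s z≤n) (pullback U suc Finₚ.suc-injective) (λ _ _ _ a b → con _ _ _ (s≤s a) (s≤s b))
  with T′ , new , old , _ ← insert U F._<_ n
         (record { tree = tree T ; inhabited = inhabited T ; label = suc ∘ label T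
                 ; isometric = isometric T ; increasing = λ x y p → s≤s (increasing T x y p) })
         zero
         (λ x → ℕₚ.n≢0⇒n>0 λ e → Finₚ.0≢1+n (dist-zero U e)) (λ x → dist-≤ U _ _) (λ x → s≤s z≤n)
         (λ x y p → con _ _ _ (s≤s z≤n) (s≤s (increasing T x y p))) =
  T′ , λ { zero → new
         ; (suc x) → proj₁ (old (proj₁ (sur x))) ,
                     trans (proj₂ (old (proj₁ (sur x)))) (cong suc (proj₂ (sur x))) }

-- Linear orders and their ranks.

injective⇒surjective : ∀ {n} (f : Fin n → Fin n) → (∀ {x y} → f x ≡ f y → x ≡ y) → ∀ y → ∃ λ x → f x ≡ y
injective⇒surjective f inj y with Finₚ.any? (λ x → f x Finₚ.≟ y)
... | yes p = p
injective⇒surjective {suc n} f inj y | no ¬p = contradiction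
  (Finₚ.injective⇒≤ {f = λ x → punchOut {i = y} {f x} (λ e → ¬p (x , sym e))}
    (λ {i} {j} e → inj (Finₚ.punchOut-injective {i = y} {f i} {f j} (λ e → ¬p (i , sym e)) (λ e → ¬p (j , sym e)) e)))
  (ℕₚ.n≮n n)

least : ∀ {n} {P : Fin n → Set} → Decidable P → ∃ P → ∃ λ m → P m × ∀ j → P j → m F.≤ j
least {suc n} P? w with P? zero
... | yes p = zero , p , λ _ _ → z≤n
least {suc n} P? (zero , p)  | no ¬p = contradiction p ¬p
least {suc n} P? (suc i , p) | no ¬p with m , q , l ← least (P? ∘ suc) (i , p) =
  suc m , q , λ { zero r → contradiction r ¬p ; (suc j) r → s≤s (l j r) }

⟦_⟧ : ∀ {n} {P : Fin n → Set} → Decidable P → Subset n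
⟦ P? ⟧ = Vec.tabulate (does ∘ P?)

∈⟦⟧⁺ : ∀ {n} {P : Fin n → Set} (P? : Decidable P) {i} → P i → i Subset.∈ ⟦ P? ⟧
∈⟦⟧⁺ P? {i} p = Vecₚ.lookup⇒[]= i _ (trans (Vecₚ.lookup∘tabulate (does ∘ P?) i) (dec-true (P? i) p))

∈⟦⟧⁻ : ∀ {n} {P : Fin n → Set} (P? : Decidable P) {i} → i Subset.∈ ⟦ P? ⟧ → P i
∈⟦⟧⁻ P? {i} m with P? i | trans (sym (Vecₚ.lookup∘tabulate (does ∘ P?) i)) (Vecₚ.[]=⇒lookup m)
... | yes p | _ = p

record Linear {P : Set} (_≺_ : P → P → Set) : Set where
  field
    irrefl : ∀ {x} → ¬ (x ≺ x)
    transᴸ : ∀ {x y z} → x ≺ y → y ≺ z → x ≺ z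
    connex : ∀ x y → x ≺ y ⊎ x ≡ y ⊎ y ≺ x

  dec : ∀ x y → Dec (x ≺ y)
  dec x y with connex x y
  ... | inj₁ p           = yes p
  ... | inj₂ (inj₁ refl) = no irrefl
  ... | inj₂ (inj₂ q)    = no λ p → irrefl (transᴸ p q)

open Linear

On : ∀ {P Q : Set} → (Q → Q → Set) → (P → Q) → P → P → Set
On _≺_ h x y = h x ≺ h y

linear-on : ∀ {P Q : Set} {_≺_ : Q → Q → Set} → Linear _≺_ → (h : P → Q) →
            (∀ {x y} → h x ≡ h y → x ≡ y) → Linear (On _≺_ h)
linear-on {P} {Q} {_≺_} L h inj = record { irrefl = irrefl L ; transᴸ = transᴸ L ; connex = go }
  where
  go : ∀ x y → On _≺_ h x y ⊎ x ≡ y ⊎ On _≺_ h y x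
  go x y with connex L (h x) (h y)
  ... | inj₁ p        = inj₁ p
  ... | inj₂ (inj₁ e) = inj₂ (inj₁ (inj e))
  ... | inj₂ (inj₂ p) = inj₂ (inj₂ p)

convex-on : ∀ {P Q : Set} {m n} (U : Ultra P m) (V : Ultra Q n) {_≺_ : Q → Q → Set} → Convex V _≺_ →
            (h : P → Q) → Isometric U V h → Convex U (On _≺_ h)
convex-on U V con h iso x y z p q = subst₂ _≤_ (iso x y) (iso x z) (con _ _ _ p q)

reflects : ∀ {P Q : Set} {_≺_ : P → P → Set} {_⊏_ : Q → Q → Set} → Linear _≺_ → Linear _⊏_ →
           (f : P → Q) → Increasing _≺_ _⊏_ f → ∀ {x y} → f x ⊏ f y → x ≺ y
reflects L M f inc {x} {y} p with connex L x y
... | inj₁ q           = q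
... | inj₂ (inj₁ refl) = ⊥-elim (irrefl M p)
... | inj₂ (inj₂ q)    = ⊥-elim (irrefl M (transᴸ M p (inc y x q)))

increasing-injective : ∀ {P Q : Set} {_≺_ : P → P → Set} {_⊏_ : Q → Q → Set} → Linear _≺_ → Linear _⊏_ →
                       (f : P → Q) → Increasing _≺_ _⊏_ f → ∀ {x y} → f x ≡ f y → x ≡ y
increasing-injective {_⊏_ = _⊏_} L M f inc {x} {y} e with connex L x y
... | inj₁ q        = ⊥-elim (irrefl M (subst (_⊏ f y) e (inc x y q)))
... | inj₂ (inj₁ q) = q
... | inj₂ (inj₂ q) = ⊥-elim (irrefl M (subst (f y ⊏_) e (inc y x q)))

fin-linear : ∀ {n} → Linear (F._<_ {n})
fin-linear = record { irrefl = Finₚ.<-irrefl refl ; transᴸ = Finₚ.<-trans ; connex = go }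
  where
  go : ∀ {n} (x y : Fin n) → x F.< y ⊎ x ≡ y ⊎ y F.< x
  go x y with Finₚ.<-cmp x y
  ... | tri< p _ _ = inj₁ p
  ... | tri≈ _ p _ = inj₂ (inj₁ p)
  ... | tri> _ _ p = inj₂ (inj₂ p)

module _ {n} {_≺_ : Fin n → Fin n → Set} (L : Linear _≺_) where

  below : Fin n → Subset n
  below x = ⟦ (λ y → dec L y x) ⟧

  below-< : ∀ x → ∣ below x ∣ < n
  below-< x = subst (∣ below x ∣ <_) (Subsetₚ.∣⊤∣≡n n) (Subsetₚ.p⊂q⇒∣p∣<∣q∣
    ((λ _ → Subsetₚ.∈⊤) , x , Subsetₚ.∈⊤ , λ m → irrefl L (∈⟦⟧⁻ (λ y → dec L y x) m)))

  rank : Fin n → Fin n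
  rank x = fromℕ< (below-< x)

  rank-increasing : Increasing _≺_ F._<_ rank
  rank-increasing x y p = subst₂ _<_ (sym (Finₚ.toℕ-fromℕ< (below-< x))) (sym (Finₚ.toℕ-fromℕ< (below-< y)))
    (Subsetₚ.p⊂q⇒∣p∣<∣q∣
      ((λ {z} m → ∈⟦⟧⁺ (λ w → dec L w y) (transᴸ L (∈⟦⟧⁻ (λ w → dec L w x) m) p)) ,
       x , ∈⟦⟧⁺ (λ w → dec L w y) p , λ m → irrefl L (∈⟦⟧⁻ (λ w → dec L w x) m)))

  rank-injective : ∀ {x y} → rank x ≡ rank y → x ≡ y
  rank-injective = increasing-injective L fin-linear rank rank-increasing

  rank-surjective : ∀ y → ∃ λ x → rank x ≡ y
  rank-surjective = injective⇒surjective rank rank-injective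

module _ {p} (r s : Fin p → Fin p) (r-sur : ∀ y → ∃ λ x → r x ≡ y)
         (inc : ∀ x y → r x F.< r y → s x F.< s y) where

  -- The point just before `x` under `r` has a strictly smaller rank under `s`, so `s` gains at
  -- least one at every step of `r`.
  ranks-≤ : ∀ k x → toℕ (r x) ≡ k → k ≤ toℕ (s x)
  ranks-≤ zero    x e = z≤n
  ranks-≤ (suc k) x e with y , ry ← r-sur (fromℕ< (ℕₚ.≤-trans (ℕₚ.n≤1+n (suc k))
                                             (subst (λ w → suc w ≤ p) e (Finₚ.toℕ<n (r x))))) =
    ℕₚ.≤-trans (s≤s (ranks-≤ k y ek)) (inc y x (subst₂ _<_ (sym ek) (sym e) ℕₚ.≤-refl))
    where
    ek : toℕ (r y) ≡ k
    ek = trans (cong toℕ ry) (Finₚ.toℕ-fromℕ< _)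

-- Orderings are stored as ranks; this turns agreement of two orders into equality of their ranks.
ranks-unique : ∀ {p} (r s : Fin p → Fin p) → (∀ y → ∃ λ x → r x ≡ y) → (∀ y → ∃ λ x → s x ≡ y) →
  (∀ x y → r x F.< r y → s x F.< s y) → (∀ x y → s x F.< s y → r x F.< r y) → ∀ x → r x ≡ s x
ranks-unique r s r-sur s-sur i j x =
  Finₚ.≤-antisym (ranks-≤ r s r-sur i _ x refl) (ranks-≤ s r s-sur j _ x refl)

lt-linear : ∀ n t → Linear (lt n {t})
lt-linear n t = record
  { irrefl = λ {x} → lt-irrefl n x ; transᴸ = λ {x} {y} {z} → lt-trans n x y z ; connex = lt-connex n }

-- Regular trees.

-- With `N` children everywhere there is room for every space of `N` points with levels up to `n`,
-- and any permutation of the children of a vertex acts isometrically on the leaves.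
regular : ℕ → ∀ n → Tree n
regular N zero    = tt
regular N (suc n) = replicate N (regular N n)

module _ {n : ℕ} {t : Tree n} where

  at : ∀ {N} → Fin N → Leaf n t → Leaf (suc n) (replicate N t)
  at zero    u = here u
  at (suc a) u = there (at a u)

  data AtView {N} : Leaf (suc n) (replicate N t) → Set where
    at-view : ∀ a u → AtView (at a u)

  atView : ∀ {N} (x : Leaf (suc n) (replicate N t)) → AtView {N} x
  atView {suc N} (here u)  = at-view zero u
  atView {suc N} (there x) with atView {N} x
  ... | at-view a u = at-view (suc a) u

  δ-at : ∀ {N} (a : Fin N) u v → δ (suc n) (at a u) (at a v) ≡ δ n u v
  δ-at zero    u v = refl
  δ-at (suc a) u v = δ-at a u v

  δ-at-≢ : ∀ {N} (a b : Fin N) u v → a ≢ b → δ (suc n) (at a u) (at b v) ≡ suc n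
  δ-at-≢ zero    zero    u v ne = contradiction refl ne
  δ-at-≢ zero    (suc b) u v ne = refl
  δ-at-≢ (suc a) zero    u v ne = refl
  δ-at-≢ (suc a) (suc b) u v ne = δ-at-≢ a b u v (ne ∘ cong suc)

  lt-at : ∀ {N} (a : Fin N) {u v} → lt n u v → lt (suc n) (at a u) (at a v)
  lt-at zero    p = p
  lt-at (suc a) p = lt-at a p

  lt-at⁻ : ∀ {N} (a : Fin N) {u v} → lt (suc n) (at a u) (at a v) → lt n u v
  lt-at⁻ zero    p = p
  lt-at⁻ (suc a) p = lt-at⁻ a p

  lt-at-< : ∀ {N} (a b : Fin N) u v → a F.< b → lt (suc n) (at a u) (at b v)
  lt-at-< zero    (suc b) u v p       = tt
  lt-at-< (suc a) (suc b) u v (s≤s p) = lt-at-< a b u v p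

  private
    V : Ultra (Leaf n t) n
    V = leafUltra n t

  module _ {N : ℕ} where

    private
      W : Ultra (Leaf (suc n) (replicate N t)) (suc n)
      W = leafUltra (suc n) (replicate N t)

    at-injective : ∀ {a b : Fin N} {u v : Leaf n t} → at a u ≡ at b v → a ≡ b
    at-injective {a} {b} {u} {v} e with a Finₚ.≟ b
    ... | yes q = q
    ... | no ne with () ← trans (sym (δ-at-≢ a b u v ne))
                            (trans (cong (δ (suc n) (at a u)) (sym e)) (δ-refl (suc n) (at a u)))

    at-iso : ∀ a → Isometric V W (at a)
    at-iso a u v = δ-at a u v

    module _ (IH : ∀ (_≺_ : Leaf n t → Leaf n t → Set) → Linear _≺_ → Convex V _≺_ →
               Σ (Leaf n t → Leaf n t) λ π → Isometric V V π × Increasing (lt n) _≺_ π)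
             (_≺_ : Leaf (suc n) (replicate N t) → Leaf (suc n) (replicate N t) → Set)
             (L : Linear _≺_) (con : Convex W _≺_)
             (σ : Fin N → Fin N) (σ-≢ : ∀ {a b} → a ≢ b → σ a ≢ σ b)
             (σ-blocks : ∀ a b u v → a F.< b → at (σ a) u ≺ at (σ b) v) where

      private
        rec : ∀ a → Σ (Leaf n t → Leaf n t) λ π → Isometric V V π × Increasing (lt n) (On _≺_ (at (σ a))) π
        rec a = IH (On _≺_ (at (σ a)))
          (linear-on L (at (σ a)) (isometric-injective V W (at-iso (σ a))))
          (convex-on V W con (at (σ a)) (at-iso (σ a)))

        π : Leaf (suc n) (replicate N t) → Leaf (suc n) (replicate N t)
        π x with atView x
        ... | at-view a u = at (σ a) (proj₁ (rec a) u)

        π-iso : Isometric W W π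
        π-iso x y with atView x | atView y
        ... | at-view a u | at-view b v with a Finₚ.≟ b
        ...   | yes refl = trans (δ-at (σ a) _ _) (trans (proj₁ (proj₂ (rec a)) u v) (sym (δ-at a u v)))
        ...   | no ne    = trans (δ-at-≢ _ _ _ _ (σ-≢ ne)) (sym (δ-at-≢ a b u v ne))

        π-inc : ∀ x y → lt (suc n) x y → π x ≺ π y
        π-inc x y p with atView x | atView y
        ... | at-view a u | at-view b v with Finₚ.<-cmp a b
        ...   | tri< q ne _   = σ-blocks a b _ _ q
        ...   | tri≈ _ refl _ = proj₂ (proj₂ (rec a)) u v (lt-at⁻ a p)
        ...   | tri> _ _ q    = ⊥-elim (lt-irrefl (suc n) (at a u)
                                  (lt-trans (suc n) (at a u) (at b v) (at a u) p (lt-at-< b a v u q)))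

      -- Child `a` moves to child `σ a`, with the inner reordering that `IH` gives for the order
      -- found there. Distances are kept because all children are the same tree `t` and `σ` keeps
      -- distinct children distinct.
      reorder-blocks : Σ (Leaf (suc n) (replicate N t) → Leaf (suc n) (replicate N t)) λ π →
        Isometric W W π × Increasing (lt (suc n)) _≺_ π
      reorder-blocks = π , π-iso , π-inc

    module _ (u₀ : Leaf n t)
             (IH : ∀ (_≺_ : Leaf n t → Leaf n t → Set) → Linear _≺_ → Convex V _≺_ →
               Σ (Leaf n t → Leaf n t) λ π → Isometric V V π × Increasing (lt n) _≺_ π)
             (_≺_ : Leaf (suc n) (replicate N t) → Leaf (suc n) (replicate N t) → Set)
             (L : Linear _≺_) (con : Convex W _≺_) where

      private
        L₀ : Linear (On _≺_ (λ a → at a u₀))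
        L₀ = linear-on L _ at-injective

        σ : Fin N → Fin N
        σ a = proj₁ (rank-surjective L₀ a)

        σ-inc : ∀ {a b} → a F.< b → at (σ a) u₀ ≺ at (σ b) u₀
        σ-inc {a} {b} p = reflects L₀ fin-linear (rank L₀) (rank-increasing L₀)
          (subst₂ F._<_ (sym (proj₂ (rank-surjective L₀ a))) (sym (proj₂ (rank-surjective L₀ b))) p)

        σ-≢ : ∀ {a b} → a ≢ b → σ a ≢ σ b
        σ-≢ {a} {b} ne e = ne (trans (sym (proj₂ (rank-surjective L₀ a)))
                                (trans (cong (rank L₀) e) (proj₂ (rank-surjective L₀ b))))

        -- The outer leaves are at most `n` apart, while the middle one, in another child, is
        -- `suc n` away from them; convexity forbids this.
        separated : ∀ a b u v w → a ≢ b → at a u ≺ at b v → at b v ≺ at a w → ⊥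
        separated a b u v w ne p q = ℕₚ.n≮n n
          (ℕₚ.≤-trans (subst₂ _≤_ (δ-at-≢ a b u v ne) (δ-at a u w) (con _ _ _ p q)) (δ-≤ n u w))

        -- If `at b v` came before `at a u`, then, on whichever side of `at a u` the leaf `at b u₀`
        -- lies, one of the two children would have leaves on both sides of a leaf of the other.
        whole-blocks : ∀ a b u v → a ≢ b → at a u₀ ≺ at b u₀ → at a u ≺ at b v
        whole-blocks a b u v ne p with connex L (at a u) (at b v)
        ... | inj₁ q        = q
        ... | inj₂ (inj₁ e) = contradiction (at-injective e) ne
        ... | inj₂ (inj₂ q) with connex L (at a u) (at b u₀)
        ...   | inj₁ q′        = ⊥-elim (separated b a v u u₀ (ne ∘ sym) q q′)
        ...   | inj₂ (inj₁ e)  = contradiction (at-injective e) ne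
        ...   | inj₂ (inj₂ q′) = ⊥-elim (separated a b u₀ u₀ u ne p q′)

      reorder-step : Σ (Leaf (suc n) (replicate N t) → Leaf (suc n) (replicate N t)) λ π →
        Isometric W W π × Increasing (lt (suc n)) _≺_ π
      reorder-step = reorder-blocks IH _≺_ L con σ σ-≢
        λ a b u v p → whole-blocks (σ a) (σ b) u v (σ-≢ (Finₚ.<⇒≢ p)) (σ-inc p)

regular-leaf : ∀ {N} n → 1 ≤ N → Leaf n (regular N n)
regular-leaf         zero    _   = tt
regular-leaf {suc N} (suc n) 0<N = here (regular-leaf n 0<N)

-- Centring every ball at its least element turns a point into the sequence of centres of the balls
-- around it; when the natural order is convex, this sequence is monotone in the point.
module _ {N m} (U : Ultra (Fin N) m) where

  ball : ∀ n x → ∃ λ c → dist U x c ≤ n × (∀ j → dist U x j ≤ n → c F.≤ j)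
  ball n x = least (λ j → dist U x j ℕₚ.≤? n) (x , subst (_≤ n) (sym (dist-refl U x)) z≤n)

  centre : ℕ → Fin N → Fin N
  centre n x = proj₁ (ball n x)

  centre-close : ∀ n x → dist U x (centre n x) ≤ n
  centre-close n x = proj₁ (proj₂ (ball n x))

  close-sym : ∀ {x y n} → dist U x y ≤ n → dist U y x ≤ n
  close-sym {x} {y} = subst (_≤ _) (dist-sym U x y)

  centre-≤ : ∀ n x y → dist U x y ≤ n → centre n x F.≤ centre n y
  centre-≤ n x y p = proj₂ (proj₂ (ball n x)) _ (dist-ultra U x y _ p (centre-close n y))

  centre-≡ : ∀ n x y → dist U x y ≤ n → centre n x ≡ centre n y
  centre-≡ n x y p = Finₚ.≤-antisym (centre-≤ n x y p) (centre-≤ n y x (close-sym p))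

  centre-≢ : ∀ n x y → ¬ dist U x y ≤ n → centre n x ≢ centre n y
  centre-≢ n x y ¬p e = ¬p (dist-ultra U x _ y (centre-close n x)
    (subst (λ c → dist U c y ≤ n) (sym e) (close-sym (centre-close n y))))

  -- The child taken at height `suc n` is named by the centre of the ball of radius `n`. Two points
  -- thus part at the vertex whose height is their distance, and `N` names suffice.
  encode : ∀ n → Fin N → Leaf n (regular N n)
  encode zero    x = tt
  encode (suc n) x = at (centre n x) (encode n x)

  encode-δ : ∀ n x y → dist U x y ≤ n → δ n (encode n x) (encode n y) ≡ dist U x y
  encode-δ zero    x y p = sym (ℕₚ.n≤0⇒n≡0 p)
  encode-δ (suc n) x y p with dist U x y ℕₚ.≤? n
  ... | yes q rewrite centre-≡ n x y q = trans (δ-at (centre n y) _ _) (encode-δ n x y q)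
  ... | no ¬q = trans (δ-at-≢ _ _ _ _ (centre-≢ n x y ¬q)) (ℕₚ.≤-antisym (ℕₚ.≰⇒> ¬q) p)

  encode-isometric : Isometric U (leafUltra m (regular N m)) (encode m)
  encode-isometric x y = encode-δ m x y (dist-≤ U x y)

  module _ (con : Convex U F._<_) where

    encode-lt : ∀ n x y → dist U x y ≤ n → x F.< y → lt n (encode n x) (encode n y)
    encode-lt zero    x y p x<y with refl ← dist-zero U (ℕₚ.n≤0⇒n≡0 p) = contradiction x<y (Finₚ.<-irrefl refl)
    encode-lt (suc n) x y p x<y with dist U x y ℕₚ.≤? n
    ... | yes q rewrite centre-≡ n x y q = lt-at (centre n y) (encode-lt n x y q x<y)
    ... | no ¬q with Finₚ.<-cmp (centre n x) (centre n y)
    ...   | tri< c _ _ = lt-at-< _ _ _ _ c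
    ...   | tri≈ _ c _ = contradiction c (centre-≢ n x y ¬q)
    -- Here `centre n y` precedes `x` and `x` precedes `y`, so convexity would put `x` into the ball
    -- of radius `n` around `y`.
    ...   | tri> _ _ c = contradiction
            (dist-ultra U x (centre n y) y
              (close-sym (ℕₚ.≤-trans (con _ _ _ cy<x x<y) (close-sym (centre-close n y))))
              (close-sym (centre-close n y))) ¬q
      where
      cy<x : centre n y F.< x
      cy<x = ℕₚ.<-≤-trans c (proj₂ (proj₂ (ball n x)) x (subst (_≤ n) (sym (dist-refl U x)) z≤n))

    encode-increasing : Increasing F._<_ (lt m) (encode m)
    encode-increasing x y = encode-lt m x y (dist-≤ U x y)

reorder : ∀ {N} n → 1 ≤ N → (_≺_ : Leaf n (regular N n) → Leaf n (regular N n) → Set) → Linear _≺_ →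
  Convex (leafUltra n (regular N n)) _≺_ → Σ (Leaf n (regular N n) → Leaf n (regular N n)) λ π →
  Isometric (leafUltra n (regular N n)) (leafUltra n (regular N n)) π × Increasing (lt n) _≺_ π
reorder zero    0<N _≺_ L con = (λ x → x) , (λ x y → refl) , λ _ _ ()
reorder (suc n) 0<N = reorder-step (regular-leaf n 0<N) (reorder n 0<N)

-- Spaces with distances in S.

module _ (S : DistOrder) where
  open DistOrder S renaming (Carrier to D; _<_ to _<ᴰ_)
  open IsStrictTotalOrder isSTO using (compare) renaming (irrefl to <ᴰ-irrefl; trans to <ᴰ-trans)
  open FUS

  private
    _≤ˢ_ : Maybe D → Maybe D → Set
    _≤ˢ_ = _≤ᵈ_ S

  ≤ᵈ-refl : ∀ a → a ≤ˢ a
  ≤ᵈ-refl nothing  = tt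
  ≤ᵈ-refl (just a) = inj₂ refl

  _<ˢ_ : Maybe D → Maybe D → Set
  _       <ˢ nothing = ⊥
  nothing <ˢ just b  = ⊤
  just a  <ˢ just b  = a <ᴰ b

  <ˢ⇒≤ : ∀ {a b} → a <ˢ b → a ≤ˢ b
  <ˢ⇒≤ {nothing} {just b} p = tt
  <ˢ⇒≤ {just a}  {just b} p = inj₁ p

  <ˢ⇒≱ : ∀ {a b} → a <ˢ b → ¬ (b ≤ˢ a)
  <ˢ⇒≱ {just a} {just b} p (inj₁ q)    = <ᴰ-irrefl refl (<ᴰ-trans p q)
  <ˢ⇒≱ {just a} {just b} p (inj₂ refl) = <ᴰ-irrefl refl p

  Chain : List D → Set
  Chain = AllPairs _<ᴰ_

  val : List D → ℕ → Maybe D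
  val c       zero          = nothing
  -- A default beyond the end of the list: the levels in use are at most the length of the chain.
  val []      (suc i)       = nothing
  val (x ∷ c) (suc zero)    = just x
  val (x ∷ c) (suc (suc i)) = val c (suc i)

  val-mono : ∀ {c} → Chain c → ∀ {i j} → i < j → j ≤ length c → val c i <ˢ val c j
  val-mono {x ∷ c} _        {zero}  {suc zero}          _       _       = tt
  val-mono {x ∷ c} (_ ∷ ch) {zero}  {suc (suc j)}       _       (s≤s l) = val-mono ch {0} {suc j} (s≤s z≤n) l
  val-mono {x ∷ c} _        {suc _} {suc zero}          (s≤s ()) _
  val-mono {x ∷ c} (_ ∷ ch) {suc (suc i)} {suc (suc j)} (s≤s p) (s≤s l) = val-mono ch p l
  val-mono {x ∷ c} (a ∷ _)  {suc zero} {suc (suc j)}    _       (s≤s l) = go c a j l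
    where
    go : ∀ c → All (x <ᴰ_) c → ∀ j → suc j ≤ length c → just x <ˢ val c (suc j)
    go (y ∷ c) (p ∷ _)  zero    _       = p
    go (y ∷ c) (_ ∷ ps) (suc j) (s≤s l) = go c ps j l

  val-index : ∀ {c a} → a ∈ c → ∃ λ i → i < length c × val c (suc i) ≡ just a
  val-index (here refl) = 0 , s≤s z≤n , refl
  val-index (there m) with i , l , e ← val-index m = suc i , s≤s l , e

  insertᶜ : D → List D → List D
  insertᶜ x []      = x ∷ []
  insertᶜ x (y ∷ c) with compare x y
  ... | tri< _ _ _ = x ∷ y ∷ c
  ... | tri≈ _ _ _ = y ∷ c
  ... | tri> _ _ _ = y ∷ insertᶜ x c

  insertᶜ-All : ∀ {P : D → Set} {x} c → P x → All P c → All P (insertᶜ x c)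
  insertᶜ-All         []      p []       = p ∷ []
  insertᶜ-All {x = x} (y ∷ c) p (q ∷ qs) with compare x y
  ... | tri< _ _ _ = p ∷ q ∷ qs
  ... | tri≈ _ _ _ = q ∷ qs
  ... | tri> _ _ _ = q ∷ insertᶜ-All c p qs

  insertᶜ-Chain : ∀ x c → Chain c → Chain (insertᶜ x c)
  insertᶜ-Chain x []      []       = [] ∷ []
  insertᶜ-Chain x (y ∷ c) (a ∷ ch) with compare x y
  ... | tri< p _ _ = (p ∷ All.map (<ᴰ-trans p) a) ∷ a ∷ ch
  ... | tri≈ _ _ _ = a ∷ ch
  ... | tri> _ _ q = insertᶜ-All c q a ∷ insertᶜ-Chain x c ch

  insertᶜ-new : ∀ x c → x ∈ insertᶜ x c
  insertᶜ-new x []      = here refl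
  insertᶜ-new x (y ∷ c) with compare x y
  ... | tri< _ _ _    = here refl
  ... | tri≈ _ refl _ = here refl
  ... | tri> _ _ _    = there (insertᶜ-new x c)

  insertᶜ-old : ∀ x c {z} → z ∈ c → z ∈ insertᶜ x c
  insertᶜ-old x (y ∷ c) m with compare x y
  ... | tri< _ _ _ = there m
  ... | tri≈ _ _ _ = m
  insertᶜ-old x (y ∷ c) (here e)  | tri> _ _ _ = here e
  insertᶜ-old x (y ∷ c) (there m) | tri> _ _ _ = there (insertᶜ-old x c m)

  chain-covering : (L : List (Maybe D)) → Σ (List D) λ c → Chain c × (∀ a → just a ∈ L → a ∈ c)
  chain-covering [] = [] , [] , λ _ ()
  chain-covering (nothing ∷ L) with c , ch , m ← chain-covering L = c , ch , λ { a (there q) → m a q }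
  chain-covering (just x ∷ L) with c , ch , m ← chain-covering L =
    insertᶜ x c , insertᶜ-Chain x c ch ,
    λ { a (here refl) → insertᶜ-new x c ; a (there q) → insertᶜ-old x c (m a q) }

  -- Levels 0, …, n name the distance 0 and the members s₁ < … < sₙ of a finite subset of S.
  record Scale (n : ℕ) : Set where
    field
      value          : ℕ → Maybe D
      value-zero     : value 0 ≡ nothing
      value-≤        : ∀ {i j} → j ≤ n → i ≤ j → value i ≤ˢ value j
      value-reflects : ∀ {i j} → i ≤ n → value i ≤ˢ value j → i ≤ j

    value-injective : ∀ {i j} → i ≤ n → j ≤ n → value i ≡ value j → i ≡ j
    value-injective {i} {j} p q e = ℕₚ.≤-antisym
      (value-reflects p (subst (value i ≤ˢ_) e (≤ᵈ-refl (value i))))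
      (value-reflects q (subst (value j ≤ˢ_) (sym e) (≤ᵈ-refl (value j))))

  open Scale

  chainScale : ∀ c → Chain c → Scale (length c)
  chainScale c ch = record
    { value = val c ; value-zero = refl ; value-≤ = mono
    ; value-reflects = λ {i} {j} p q → ℕₚ.≮⇒≥ λ r → <ˢ⇒≱ (val-mono ch r p) q }
    where
    mono : ∀ {i j} → j ≤ length c → i ≤ j → val c i ≤ˢ val c j
    mono {i} {j} p q with ℕₚ.m≤n⇒m<n∨m≡n q
    ... | inj₁ r    = <ˢ⇒≤ (val-mono ch r p)
    ... | inj₂ refl = ≤ᵈ-refl (val c i)

  distances : FUS S → List (Maybe D)
  distances X = cartesianProductWith (d X) (allFin (size X)) (allFin (size X))

  distances-complete : ∀ X x y → d X x y ∈ distances X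
  distances-complete X x y = ∈-cartesianProductWith⁺ (d X) (∈-allFin x) (∈-allFin y)

  Presents : ∀ {n} → Scale n → (X : FUS S) → Ultra (Fin (size X)) n → Set
  Presents sc X U = ∀ x y → value sc (dist U x y) ≡ d X x y

  levels : ∀ {n} (sc : Scale n) X → (∀ x y → ∃ λ i → i ≤ n × value sc i ≡ d X x y) →
           Σ (Ultra (Fin (size X)) n) (Presents sc X)
  levels {n} sc X cov = U , pr
    where
    δᶠ : Fin (size X) → Fin (size X) → ℕ
    δᶠ x y = proj₁ (cov x y)
    bd : ∀ x y → δᶠ x y ≤ n
    bd x y = proj₁ (proj₂ (cov x y))
    pr : ∀ x y → value sc (δᶠ x y) ≡ d X x y
    pr x y = proj₂ (proj₂ (cov x y))
    refl′ : ∀ x → δᶠ x x ≡ 0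
    refl′ x = value-injective sc (bd x x) z≤n (trans (pr x x) (trans (d-self X x) (sym (value-zero sc))))
    ult : ∀ x y z {m} → δᶠ x y ≤ m → δᶠ y z ≤ m → δᶠ x z ≤ m
    ult x y z p q with ultra X x y z
    ... | inj₁ l = ℕₚ.≤-trans (value-reflects sc (bd x z) (subst₂ _≤ˢ_ (sym (pr x z)) (sym (pr x y)) l)) p
    ... | inj₂ l = ℕₚ.≤-trans (value-reflects sc (bd x z) (subst₂ _≤ˢ_ (sym (pr x z)) (sym (pr y z)) l)) q
    U : Ultra (Fin (size X)) n
    U = record
      { dist = δᶠ ; dist-refl = refl′
      ; dist-zero = λ {x} {y} e → d-pos X x y (trans (sym (pr x y)) (trans (cong (value sc) e) (value-zero sc)))
      ; dist-sym = λ x y → value-injective sc (bd x y) (bd y x)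
                             (trans (pr x y) (trans (d-sym X x y) (sym (pr y x))))
      ; dist-ultra = ult ; dist-≤ = bd }

  covering-scale : ∀ (L : List (Maybe D)) → ∃ λ n → Σ (Scale n) λ sc →
    ∀ a → a ∈ L → ∃ λ i → i ≤ n × value sc i ≡ a
  covering-scale L with c , ch , m ← chain-covering L = length c , chainScale c ch , go
    where
    go : ∀ a → a ∈ L → ∃ λ i → i ≤ length c × val c i ≡ a
    go nothing  _ = 0 , z≤n , refl
    go (just a) q with i , l , e ← val-index (m a q) = suc i , l , e

  toFUS : ∀ {n N} → Scale n → Ultra (Fin N) n → FUS S
  toFUS {n} {N} sc U = record
    { size = N ; d = λ x y → value sc (dist U x y)
    ; d-self = λ x → trans (cong (value sc) (dist-refl U x)) (value-zero sc)
    ; d-pos = λ x y e → dist-zero U (value-injective sc (dist-≤ U x y) z≤n (trans e (sym (value-zero sc))))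
    ; d-sym = λ x y → cong (value sc) (dist-sym U x y)
    ; ultra = ult }
    where
    ult : ∀ x y z → (value sc (dist U x z) ≤ˢ value sc (dist U x y)) ⊎
                    (value sc (dist U x z) ≤ˢ value sc (dist U y z))
    ult x y z with ℕₚ.≤-total (dist U x y) (dist U y z)
    ... | inj₁ l = inj₂ (value-≤ sc (dist-≤ U y z) (dist-ultra U x y z l ℕₚ.≤-refl))
    ... | inj₂ l = inj₁ (value-≤ sc (dist-≤ U x y) (dist-ultra U x y z ℕₚ.≤-refl l))

  d-isometric : ∀ {n} (sc : Scale n) X Z {U V} → Presents sc X U → Presents sc Z V →
    ∀ {f} → (∀ x y → d Z (f x) (f y) ≡ d X x y) → Isometric U V f
  d-isometric sc X Z {U} {V} pX pZ iso x y =
    value-injective sc (dist-≤ V _ _) (dist-≤ U x y) (trans (pZ _ _) (trans (iso x y) (sym (pX x y))))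

  isometric-d : ∀ {n} (sc : Scale n) X Z {U V} → Presents sc X U → Presents sc Z V →
    ∀ {f} → Isometric U V f → ∀ x y → d Z (f x) (f y) ≡ d X x y
  isometric-d sc X Z pX pZ iso x y = trans (sym (pZ _ _)) (trans (cong (value sc) (iso x y)) (pX x y))

  -- Convex orderings as rank vectors.

  Before : ∀ {N} → Vec (Fin N) N → Fin N → Fin N → Set
  Before r x y = lookup r x F.< lookup r y

  clo-injective : ∀ X {r} → IsCLO S X r → ∀ {x y} → lookup r x ≡ lookup r y → x ≡ y
  clo-injective X c = proj₁ (proj₁ c) _ _

  clo-linear : ∀ X {r} → IsCLO S X r → Linear (Before r)
  clo-linear X {r} c = linear-on fin-linear (lookup r) (clo-injective X {r} c)

  -- Apply convexity to the ball centred at `x` with `z` on its boundary: both ends of the interval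
  -- lie in it.
  clo-between : ∀ X {r} → IsCLO S X r → ∀ x y z → Before r x y → Before r y z → d X x y ≤ˢ d X x z
  clo-between X c x y z p q = proj₂ c x z x y z
    (subst (_≤ˢ d X x z) (sym (d-self X x)) tt) (≤ᵈ-refl (d X x z)) p q

  clo-convex : ∀ {n} (sc : Scale n) X {U} → Presents sc X U → ∀ {r} → IsCLO S X r → Convex U (Before r)
  clo-convex sc X {U} pX {r} c x y z p q =
    value-reflects sc (dist-≤ U x y) (subst₂ _≤ˢ_ (sym (pX x y)) (sym (pX x z)) (clo-between X {r} c x y z p q))

  clo-of-order : ∀ {n} (sc : Scale n) X {U} → Presents sc X U →
    (_≺_ : Fin (size X) → Fin (size X) → Set) → Linear _≺_ → Convex U _≺_ →
    ∃ λ r → IsCLO S X r × Increasing _≺_ (Before r) (λ x → x)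
  clo-of-order {n} sc X {U} pX _≺_ L con = r , ((inj , sur) , cvx) , inc
    where
    r : Vec (Fin (size X)) (size X)
    r = tabulate (rank L)
    lk : ∀ x → lookup r x ≡ rank L x
    lk = lookup∘tabulate (rank L)
    inc : Increasing _≺_ (Before r) (λ x → x)
    inc x y p = subst₂ F._<_ (sym (lk x)) (sym (lk y)) (rank-increasing L x y p)
    inj : ∀ i j → lookup r i ≡ lookup r j → i ≡ j
    inj i j e = rank-injective L (trans (sym (lk i)) (trans e (lk j)))
    sur : ∀ j → ∃ λ i → lookup r i ≡ j
    sur j with i , e ← rank-surjective L j = i , trans (lk i) e
    refl≺ : ∀ {x y} → Before r x y → x ≺ y
    refl≺ {x} {y} p = reflects L fin-linear (rank L) (rank-increasing L) (subst₂ F._<_ (lk x) (lk y) p)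
    to-level : ∀ {a b x y} → d X a b ≤ˢ d X x y → dist U a b ≤ dist U x y
    to-level {a} {b} {x} {y} l =
      value-reflects sc (dist-≤ U a b) (subst₂ _≤ˢ_ (sym (pX a b)) (sym (pX x y)) l)
    cvx : ∀ c z a b e → d X c a ≤ˢ d X c z → d X c e ≤ˢ d X c z →
          Before r a b → Before r b e → d X c b ≤ˢ d X c z
    -- The centre `c` may lie anywhere, so the estimate passes through `a`: the distance from `a` to
    -- `b` is at most that from `a` to `e`, which is at most the radius because both lie in the
    -- ball.
    cvx c z a b e p q a<b b<e = subst₂ _≤ˢ_ (pX c b) (pX c z) (value-≤ sc (dist-≤ U c z)
      (dist-ultra U c a b (to-level p) (ℕₚ.≤-trans (con a b e (refl≺ a<b) (refl≺ b<e))
        (dist-ultra U a c e (subst (_≤ dist U c z) (dist-sym U c a) (to-level p)) (to-level q)))))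

  -- Embeddings exist only between trees of equal height, so `X` and `Y` must be measured on one
  -- scale.
  scale-for : ∀ X Y → ∃ λ n → Σ (Scale n) λ sc →
    Σ (Ultra (Fin (size X)) n) (Presents sc X) × Σ (Ultra (Fin (size Y)) n) (Presents sc Y)
  scale-for X Y with n , sc , cov ← covering-scale (distances X ++ distances Y) =
    n , sc , levels sc X (λ x y → cov _ (∈-++⁺ˡ (distances-complete X x y))) ,
    levels sc Y (λ x y → cov _ (∈-++⁺ʳ (distances X) (distances-complete Y x y)))

  -- The order of the leaves of a regular tree restricts to a convex ordering of every subspace, and
  -- `encode` makes `X` one.
  clo-exists : ∀ X → ∃ (IsCLO S X)
  clo-exists X with n , sc , (U , pX) , _ ← scale-for X X
    with r , c , _ ← clo-of-order sc X {U} pX (On (lt n) (encode U n))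
           (linear-on (lt-linear n _) (encode U n) (isometric-injective U (leafUltra n (regular (size X) n)) (encode-isometric U)))
           (convex-on U (leafUltra n _) (lt-convex n) (encode U n) (encode-isometric U)) = r , c

  module _ {n} (sc : Scale n) (X : FUS S) {U : Ultra (Fin (size X)) n} (pX : Presents sc X U)
           {r : Vec (Fin (size X)) (size X)} (c : IsCLO S X r) where

    unrank : Fin (size X) → Fin (size X)
    unrank j = proj₁ (proj₂ (proj₁ c) j)

    rank-unrank : ∀ j → lookup r (unrank j) ≡ j
    rank-unrank j = proj₂ (proj₂ (proj₁ c) j)

    unrank-rank : ∀ x → unrank (lookup r x) ≡ x
    unrank-rank x = clo-injective X {r} c (rank-unrank (lookup r x))

    unrank-injective : ∀ {i j} → unrank i ≡ unrank j → i ≡ j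
    unrank-injective {i} {j} e = trans (sym (rank-unrank i)) (trans (cong (lookup r) e) (rank-unrank j))

    -- Naming points by their ranks turns the given ordering into the natural order of `Fin`, the
    -- form in which `represent` and `encode-increasing` apply.
    rankUltra : Ultra (Fin (size X)) n
    rankUltra = pullback U unrank unrank-injective

    rankUltra-convex : Convex rankUltra F._<_
    rankUltra-convex i j k p q = clo-convex sc X {U} pX {r} c (unrank i) (unrank j) (unrank k)
      (subst₂ F._<_ (sym (rank-unrank i)) (sym (rank-unrank j)) p)
      (subst₂ F._<_ (sym (rank-unrank j)) (sym (rank-unrank k)) q)

    rank-isometric : Isometric U rankUltra (lookup r)
    rank-isometric x y = cong₂ (dist U) (unrank-rank x) (unrank-rank y)

-- Counting isometries and convex orderings.

length-unique : ∀ {A : Set} {xs ys : List A} → Unique xs → Unique ys →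
                (∀ {z} → z ∈ xs → z ∈ ys) → (∀ {z} → z ∈ ys → z ∈ xs) → length xs ≡ length ys
length-unique u v f g = ↭-length (∼bag⇒↭ (unique∧set⇒bag u v (mk⇔ f g)))

-- For the convex orderings of `X` under its isometries, `count` is the formula of the theorem: the
-- number of representatives is to be the Ramsey degree, and `a` is the size of every orbit.
record Transversal {A : Set} (orb : A → List A) (a : ℕ) (xs : List A) : Set where
  field
    reps     : List A
    count    : length reps * a ≡ length xs
    members  : All (_∈ xs) reps
    covers   : ∀ x → x ∈ xs → ∃ λ r → r ∈ reps × x ∈ orb r
    distinct : AllPairs (λ r s → s ∉ orb r) reps

open Transversal

module _ {A : Set} (_≟_ : DecidableEquality A) (orb : A → List A) (a : ℕ)
         (orb-refl  : ∀ x → x ∈ orb x)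
         (orb-sym   : ∀ {x y} → y ∈ orb x → x ∈ orb y)
         (orb-trans : ∀ {x y z} → y ∈ orb x → z ∈ orb y → z ∈ orb x)
         (orb-length : ∀ x → length (orb x) ≡ a) where

  open import Data.List.Membership.DecPropositional _≟_ using (_∈?_)

  -- The orbit of the first element is removed and the rest treated alike. The rest is a filtered
  -- list, so the recursion runs on the bound `k`; the list shrinks because `x` belongs to its own
  -- orbit.
  transversal : ∀ k xs → length xs ≤ k → Unique xs → (∀ x → x ∈ xs → Unique (orb x)) →
                (∀ x y → x ∈ xs → y ∈ orb x → y ∈ xs) → Transversal orb a xs
  transversal k       []       _       _ _ _  = record
    { reps = [] ; count = refl ; members = [] ; covers = λ _ () ; distinct = [] }
  transversal (suc k) (x ∷ xs) (s≤s l) u v cl = record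
    { reps = x ∷ reps rec
    ; count = trans (cong (a +_) (count rec)) (sym total≡)
    ; members = here refl ∷ All.map in-xs (members rec)
    ; covers = cover
    ; distinct = All.map out (members rec) ∷ distinct rec }
    where
    out? : Decidable (_∉ orb x)
    out? y = ¬? (y ∈? orb x)
    rest : List A
    rest = filter out? (x ∷ xs)
    in-xs : ∀ {y} → y ∈ rest → y ∈ (x ∷ xs)
    in-xs m = proj₁ (∈-filter⁻ out? m)
    out : ∀ {y} → y ∈ rest → y ∉ orb x
    out m = proj₂ (∈-filter⁻ out? {xs = x ∷ xs} m)
    split : ∀ {y} → y ∈ (x ∷ xs) → y ∈ (orb x ++ rest)
    split {y} m with y ∈? orb x
    ... | yes p = ∈-++⁺ˡ p
    ... | no ¬p = ∈-++⁺ʳ (orb x) (∈-filter⁺ out? m ¬p)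
    unsplit : ∀ {y} → y ∈ (orb x ++ rest) → y ∈ (x ∷ xs)
    unsplit {y} m with ∈-++⁻ (orb x) m
    ... | inj₁ p = cl x y (here refl) p
    ... | inj₂ p = in-xs p
    total≡ : length (x ∷ xs) ≡ a + length rest
    total≡ = trans (length-unique u
        (Uniqueₚ.++⁺ (v x (here refl)) (Uniqueₚ.filter⁺ out? u) λ (p , q) → out q p) split unsplit)
      (trans (length-++ (orb x)) (cong (_+ length rest) (orb-length x)))
    a>0 : 0 < a
    a>0 with orb x | orb-refl x | orb-length x
    ... | _ ∷ _ | _ | refl = s≤s z≤n
    rest≤k : length rest ≤ k
    rest≤k = ℕₚ.≤-trans (ℕₚ.≤-pred (ℕₚ.≤-trans (ℕₚ.+-monoˡ-≤ (length rest) a>0) (ℕₚ.≤-reflexive (sym total≡)))) l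
    closed : ∀ y z → y ∈ rest → z ∈ orb y → z ∈ rest
    closed y z m p = ∈-filter⁺ out? (cl y z (in-xs m) p) λ q → out m (orb-trans q (orb-sym p))
    rec : Transversal orb a rest
    rec = transversal k rest rest≤k (Uniqueₚ.filter⁺ out? u) (λ y m → v y (in-xs m)) closed
    cover : ∀ y → y ∈ (x ∷ xs) → ∃ λ r → r ∈ (x ∷ reps rec) × y ∈ orb r
    cover y m with y ∈? orb x
    ... | yes p = x , here refl , p
    ... | no ¬p with r , q , o ← covers rec y (∈-filter⁺ out? m ¬p) = r , there q , o

allVecs : ∀ N n → List (Vec (Fin N) n)
allVecs N zero    = [ Vec.[] ]
allVecs N (suc n) = cartesianProductWith Vec._∷_ (allFin N) (allVecs N n)

allVecs-complete : ∀ {N n} (v : Vec (Fin N) n) → v ∈ allVecs N n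
allVecs-complete Vec.[]      = here refl
allVecs-complete (x Vec.∷ v) = ∈-cartesianProductWith⁺ Vec._∷_ (∈-allFin x) (allVecs-complete v)

allVecs-unique : ∀ N n → Unique (allVecs N n)
allVecs-unique N zero    = [] ∷ []
allVecs-unique N (suc n) =
  Uniqueₚ.cartesianProductWith⁺ Vec._∷_ Vecₚ.∷-injective (Uniqueₚ.allFin⁺ N) (allVecs-unique N n)

enumerate : ∀ {N n} {P : Vec (Fin N) n → Set} → Decidable P → List (Vec (Fin N) n)
enumerate {N} {n} P? = filter P? (allVecs N n)

enumerate-unique : ∀ {N n} {P : Vec (Fin N) n → Set} (P? : Decidable P) → Unique (enumerate P?)
enumerate-unique {N} {n} P? = Uniqueₚ.filter⁺ P? (allVecs-unique N n)

∈-enumerate⁺ : ∀ {N n} {P : Vec (Fin N) n → Set} (P? : Decidable P) {v} → P v → v ∈ enumerate P?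
∈-enumerate⁺ P? {v} p = ∈-filter⁺ P? (allVecs-complete v) p

∈-enumerate⁻ : ∀ {N n} {P : Vec (Fin N) n → Set} (P? : Decidable P) {v} → v ∈ enumerate P? → P v
∈-enumerate⁻ {N} {n} P? m = proj₂ (∈-filter⁻ P? {xs = allVecs N n} m)

enumerate-card : ∀ {N n} {P : Vec (Fin N) n → Set} (P? : Decidable P) → HasCard P (length (enumerate P?))
enumerate-card P? = enumerate P? , enumerate-unique P? , (λ v → mk⇔ (∈-enumerate⁻ P?) (∈-enumerate⁺ P?)) , refl

vec-ext : ∀ {A : Set} {n} {u v : Vec A n} → (∀ i → lookup u i ≡ lookup v i) → u ≡ v
vec-ext {u = u} {v} e = trans (sym (tabulate∘lookup u)) (trans (tabulate-cong e) (tabulate∘lookup v))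

_∘ᵛ_ : ∀ {N} → Vec (Fin N) N → Vec (Fin N) N → Vec (Fin N) N
r ∘ᵛ φ = tabulate (λ i → lookup r (lookup φ i))

lookup-∘ᵛ : ∀ {N} (r φ : Vec (Fin N) N) i → lookup (r ∘ᵛ φ) i ≡ lookup r (lookup φ i)
lookup-∘ᵛ r φ = lookup∘tabulate (λ i → lookup r (lookup φ i))

module _ (S : DistOrder) where
  open DistOrder S renaming (Carrier to D; _<_ to _<ᴰ_)
  open IsStrictTotalOrder isSTO using (_≟_; _<?_)
  open FUS

  _≟ˢ_ : DecidableEquality (Maybe D)
  _≟ˢ_ = ≡-dec _≟_

  _≤ˢ?_ : ∀ a b → Dec (_≤ᵈ_ S a b)
  nothing ≤ˢ? _       = yes tt
  just a  ≤ˢ? nothing = no λ ()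
  just a  ≤ˢ? just b  = (a <? b) ⊎-dec (a ≟ b)

  module _ (X : FUS S) where

    isIso? : Decidable (IsIso S X)
    isIso? v = Finₚ.all? (λ i → Finₚ.all? λ j → d X (lookup v i) (lookup v j) ≟ˢ d X i j) ×-dec
               Finₚ.all? (λ j → Finₚ.any? λ i → lookup v i Finₚ.≟ j)

    isCLO? : Decidable (IsCLO S X)
    isCLO? r =
      (Finₚ.all? (λ i → Finₚ.all? λ j → (lookup r i Finₚ.≟ lookup r j) →-dec (i Finₚ.≟ j)) ×-dec
       Finₚ.all? (λ j → Finₚ.any? λ i → lookup r i Finₚ.≟ j)) ×-dec
      Finₚ.all? (λ c → Finₚ.all? λ z → Finₚ.all? λ a → Finₚ.all? λ b → Finₚ.all? λ e →
        (d X c a ≤ˢ? d X c z) →-dec ((d X c e ≤ˢ? d X c z) →-dec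
        ((lookup r a Finₚ.<? lookup r b) →-dec ((lookup r b Finₚ.<? lookup r e) →-dec
        (d X c b ≤ˢ? d X c z)))))

    isos clos : List (Vec (Fin (size X)) (size X))
    isos = enumerate isIso?
    clos = enumerate isCLO?

    iso-id : IsIso S X (tabulate (λ i → i))
    iso-id = (λ i j → cong₂ (d X) (lookup∘tabulate (λ i → i) i) (lookup∘tabulate (λ i → i) j)) ,
      λ j → j , lookup∘tabulate (λ i → i) j

    iso-∘ : ∀ φ ψ → IsIso S X φ → IsIso S X ψ → IsIso S X (φ ∘ᵛ ψ)
    iso-∘ φ ψ (p , s) (q , t) =
      (λ i j → trans (cong₂ (d X) (lookup-∘ᵛ φ ψ i) (lookup-∘ᵛ φ ψ j)) (trans (p _ _) (q i j))) ,
      λ j → proj₁ (t (proj₁ (s j))) ,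
            trans (lookup-∘ᵛ φ ψ _) (trans (cong (lookup φ) (proj₂ (t (proj₁ (s j))))) (proj₂ (s j)))

    iso-of : (f : Fin (size X) → Fin (size X)) → (∀ i j → d X (f i) (f j) ≡ d X i j) → IsIso S X (tabulate f)
    iso-of f iso = (λ i j → trans (cong₂ (d X) (lookup∘tabulate f i) (lookup∘tabulate f j)) (iso i j)) ,
      λ j → proj₁ (sur j) , trans (lookup∘tabulate f _) (proj₂ (sur j))
      where
      inj : ∀ {i j} → f i ≡ f j → i ≡ j
      inj {i} {j} e = d-pos X i j (trans (sym (iso i j)) (trans (cong (d X (f i)) (sym e)) (d-self X (f i))))
      sur : ∀ j → ∃ λ i → f i ≡ j
      sur = injective⇒surjective f inj

    iso-inverse : ∀ φ → IsIso S X φ → ∃ λ ψ → IsIso S X ψ × ∀ i → lookup φ (lookup ψ i) ≡ i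
    iso-inverse φ (p , s) = tabulate (proj₁ ∘ s) ,
      iso-of (proj₁ ∘ s) (λ i j → trans (sym (p _ _)) (cong₂ (d X) (proj₂ (s i)) (proj₂ (s j)))) ,
      λ i → trans (cong (lookup φ) (lookup∘tabulate (proj₁ ∘ s) i)) (proj₂ (s i))

    clo-∘ : ∀ r φ → IsCLO S X r → IsIso S X φ → IsCLO S X (r ∘ᵛ φ)
    clo-∘ r φ ((inj , sur) , con) (iso , s) =
      ((λ i j e → φ-inj (inj _ _ (trans (sym (lookup-∘ᵛ r φ i)) (trans e (lookup-∘ᵛ r φ j))))) ,
       (λ j → proj₁ (s (proj₁ (sur j))) ,
              trans (lookup-∘ᵛ r φ _) (trans (cong (lookup r) (proj₂ (s (proj₁ (sur j))))) (proj₂ (sur j))))) ,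
      λ c z a b e p q a<b b<e → subst₂ (_≤ᵈ_ S) (iso c b) (iso c z)
        (con _ _ _ _ _ (subst₂ (_≤ᵈ_ S) (sym (iso c a)) (sym (iso c z)) p)
                       (subst₂ (_≤ᵈ_ S) (sym (iso c e)) (sym (iso c z)) q)
                       (subst₂ F._<_ (lookup-∘ᵛ r φ a) (lookup-∘ᵛ r φ b) a<b)
                       (subst₂ F._<_ (lookup-∘ᵛ r φ b) (lookup-∘ᵛ r φ e) b<e))
      where
      φ-inj : ∀ {i j} → lookup φ i ≡ lookup φ j → i ≡ j
      φ-inj {i} {j} e = d-pos X i j (trans (sym (iso i j)) (trans (cong (d X (lookup φ i)) (sym e)) (d-self X _)))

    -- Two convex orderings lie in one orbit exactly when they make `X` into isomorphic ordered
    -- spaces.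
    orbit : Vec (Fin (size X)) (size X) → List (Vec (Fin (size X)) (size X))
    orbit r = List.map (r ∘ᵛ_) isos

    ∈-orbit⁺ : ∀ r s φ → IsIso S X φ → (∀ i → lookup s i ≡ lookup r (lookup φ i)) → s ∈ orbit r
    ∈-orbit⁺ r s φ p e = subst (_∈ orbit r) (vec-ext λ i → trans (lookup-∘ᵛ r φ i) (sym (e i)))
                                 (∈-map⁺ (r ∘ᵛ_) (∈-enumerate⁺ isIso? {φ} p))

    ∈-orbit⁻ : ∀ r {s} → s ∈ orbit r → ∃ λ φ → IsIso S X φ × ∀ i → lookup s i ≡ lookup r (lookup φ i)
    ∈-orbit⁻ r m with φ , q , refl ← ∈-map⁻ (r ∘ᵛ_) m = φ , ∈-enumerate⁻ isIso? {φ} q , lookup-∘ᵛ r φ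

    orbit-refl : ∀ r → r ∈ orbit r
    orbit-refl r = ∈-orbit⁺ r r (tabulate λ i → i) iso-id λ i → cong (lookup r) (sym (lookup∘tabulate (λ i → i) i))

    orbit-sym : ∀ {r s} → s ∈ orbit r → r ∈ orbit s
    orbit-sym {r} {s} m
      with φ , p , e ← ∈-orbit⁻ r m
      with ψ , q , inv ← iso-inverse φ p =
      ∈-orbit⁺ s r ψ q λ i → sym (trans (e (lookup ψ i)) (cong (lookup r) (inv i)))

    orbit-trans : ∀ {r s t} → s ∈ orbit r → t ∈ orbit s → t ∈ orbit r
    orbit-trans {r} {s} {t} m m′
      with φ , p , e ← ∈-orbit⁻ r m
      with ψ , q , e′ ← ∈-orbit⁻ s m′ =
      ∈-orbit⁺ r t (φ ∘ᵛ ψ) (iso-∘ φ ψ p q) λ i →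
        trans (e′ i) (trans (e (lookup ψ i)) (cong (lookup r) (sym (lookup-∘ᵛ φ ψ i))))

    -- The action is free: a ranking `r` is injective, so `r ∘ᵛ φ` determines `φ`.
    orbit-unique : ∀ r → r ∈ clos → Unique (orbit r)
    orbit-unique r m = Uniqueₚ.map⁺
      (λ {φ} {ψ} e → vec-ext λ i → clo-injective S X {r} (∈-enumerate⁻ isCLO? {r} m)
        (trans (sym (lookup-∘ᵛ r φ i)) (trans (cong (λ w → lookup w i) e) (lookup-∘ᵛ r ψ i))))
      (enumerate-unique isIso?)

    orbit-clos : ∀ r s → r ∈ clos → s ∈ orbit r → s ∈ clos
    orbit-clos r s m o with φ , q , refl ← ∈-map⁻ (r ∘ᵛ_) o =
      ∈-enumerate⁺ isCLO? {r ∘ᵛ φ} (clo-∘ r φ (∈-enumerate⁻ isCLO? {r} m) (∈-enumerate⁻ isIso? {φ} q))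

    orderTypes : Transversal orbit (length isos) clos
    orderTypes = transversal (Vecₚ.≡-dec Finₚ._≟_) orbit (length isos) orbit-refl
      (λ {r} {s} → orbit-sym {r} {s}) (λ {r} {s} {t} → orbit-trans {r} {s} {t})
      (λ r → length-map (r ∘ᵛ_) isos) (length clos) clos ℕₚ.≤-refl (enumerate-unique isCLO?)
      orbit-unique orbit-clos

-- Ramsey degrees.

module _ {a b} (f : Fin a → Fin b) where

  hit? : Decidable (λ z → ∃ λ i → f i ≡ z)
  hit? z = Finₚ.any? (λ i → f i Finₚ.≟ z)

  image : Subset b
  image = ⟦ hit? ⟧

  ∈-image : ∀ z → (z Subset.∈ image) ⇔ (∃ λ i → f i ≡ z)
  ∈-image z = mk⇔ (∈⟦⟧⁻ hit?) (∈⟦⟧⁺ hit?)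

  image-unique : ∀ {T} → (∀ z → (z Subset.∈ T) ⇔ (∃ λ i → f i ≡ z)) → T ≡ image
  image-unique m = Subsetₚ.⊆-antisym
    (λ {z} p → Equivalence.from (∈-image z) (Equivalence.to (m z) p))
    (λ {z} p → Equivalence.from (m z) (Equivalence.to (∈-image z) p))

  image-⊆ : ∀ {U} → (∀ i → f i Subset.∈ U) → image ⊆ U
  image-⊆ {U} m {z} p with i , e ← Equivalence.to (∈-image z) p = subst (Subset._∈ U) e (m i)

image-cong : ∀ {a a′ b} (f : Fin a → Fin b) (g : Fin a′ → Fin b) →
             (∀ i → ∃ λ j → g j ≡ f i) → (∀ j → ∃ λ i → f i ≡ g j) → image f ≡ image g
image-cong f g p q = Subsetₚ.⊆-antisym
  (image-⊆ f (λ i → Equivalence.from (∈-image g (f i)) (p i)))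
  (image-⊆ g (λ j → Equivalence.from (∈-image f (g j)) (q j)))

image-preimage : ∀ {a b c} (f : Fin a → Fin c) (g : Fin b → Fin c) {T} → image f ≡ T → image g ≡ T →
                 ∀ x → ∃ λ y → g y ≡ f x
image-preimage f g e e′ x = Equivalence.to (∈-image g (f x))
  (subst (f x Subset.∈_) (trans e (sym e′)) (Equivalence.from (∈-image f (f x)) (x , refl)))

allPairs-lookup : ∀ {A : Set} {_~_ : A → A → Set} {xs} → AllPairs _~_ xs →
                  ∀ i j → i F.< j → List.lookup xs i ~ List.lookup xs j
allPairs-lookup {xs = x ∷ xs} (a ∷ _) zero    (suc j) _       = All.lookup a (∈-lookup j)
allPairs-lookup (_ ∷ as)              (suc i) (suc j) (s≤s p) = allPairs-lookup as i j p

module _ (S : DistOrder) (n : ℕ) (sc : Scale S n) (W : Tree n) where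

  private
    bij : Fin (proj₁ (leaf-card n W)) ↔ Leaf n W
    bij = proj₂ (leaf-card n W)

  leaf# : ℕ
  leaf# = proj₁ (leaf-card n W)

  toLeaf : Fin leaf# → Leaf n W
  toLeaf = Inverse.to bij

  fromLeaf : Leaf n W → Fin leaf#
  fromLeaf = Inverse.from bij

  toLeaf-fromLeaf : ∀ x → toLeaf (fromLeaf x) ≡ x
  toLeaf-fromLeaf = Inverse.strictlyInverseˡ bij

  toLeaf-injective : ∀ {i j} → toLeaf i ≡ toLeaf j → i ≡ j
  toLeaf-injective {i} {j} e = trans (sym (Inverse.strictlyInverseʳ bij i))
    (trans (cong fromLeaf e) (Inverse.strictlyInverseʳ bij j))

  treeUltra : Ultra (Fin leaf#) n
  treeUltra = pullback (leafUltra n W) toLeaf toLeaf-injective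

  treeFUS : FUS S
  treeFUS = toFUS S sc treeUltra

  fromLeaf-isometric : Isometric (leafUltra n W) treeUltra fromLeaf
  fromLeaf-isometric x y = cong₂ (δ n) (toLeaf-fromLeaf x) (toLeaf-fromLeaf y)

module _ (S : DistOrder) (X : FUS S) where
  open FUS

  clo-tree : 1 ≤ size X → ∀ {n} (sc : Scale S n) {U} → Presents S sc X U → ∀ {r} → IsCLO S X r →
             Σ (Rep U (Before S r) n) λ T → ∀ x → ∃ λ y → label T y ≡ x
  clo-tree 0<N {n} sc {U} pX {r} c = relabel (represent 0<N (rankUltra S sc X {U} pX {r} c)
                                                       (rankUltra-convex S sc X {U} pX {r} c))
    where
    point : Fin (size X) → Fin (size X)
    point = unrank S sc X {U} pX {r} c
    relabel : Σ (Rep (rankUltra S sc X {U} pX {r} c) F._<_ n) (λ T → ∀ x → ∃ λ y → label T y ≡ x) →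
              Σ (Rep U (Before S r) n) λ T → ∀ x → ∃ λ y → label T y ≡ x
    relabel (T , sur) =
      record
        { tree = tree T ; inhabited = inhabited T ; label = point ∘ label T ; isometric = isometric T
        ; increasing = λ x y p → subst₂ F._<_ (sym (rank-unrank S sc X {U} pX {r} c (label T x)))
            (sym (rank-unrank S sc X {U} pX {r} c (label T y))) (increasing T x y p) } ,
      λ x → proj₁ (sur (lookup r x)) ,
        trans (cong point (proj₂ (sur (lookup r x)))) (unrank-rank S sc X {U} pX {r} c x)

  module _ (R : Transversal (orbit S X) (length (isos S X)) (clos S X)) where

    types : ℕ
    types = length (reps R)

    rep : Fin types → Vec (Fin (size X)) (size X)
    rep = List.lookup (reps R)

    rep-clo : ∀ i → IsCLO S X (rep i)
    rep-clo i = ∈-enumerate⁻ (isCLO? S X) {rep i} (All.lookup (members R) (∈-lookup i))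

    type-of : ∀ {s} → IsCLO S X s →
              ∃ λ i → ∃ λ φ → IsIso S X φ × ∀ x → lookup s x ≡ lookup (rep i) (lookup φ x)
    type-of {s} c = go (covers R s (∈-enumerate⁺ (isCLO? S X) {s} c))
      where
      go : (∃ λ r → r ∈ reps R × s ∈ orbit S X r) →
           ∃ λ i → ∃ λ φ → IsIso S X φ × ∀ x → lookup s x ≡ lookup (rep i) (lookup φ x)
      go (r , m , o) = Any.index m , proj₁ iso , proj₁ (proj₂ iso) ,
        λ x → trans (proj₂ (proj₂ iso) x) (cong (λ w → lookup w (lookup (proj₁ iso) x)) (lookup-index m))
        where
        iso : ∃ λ φ → IsIso S X φ × ∀ x → lookup s x ≡ lookup r (lookup φ x)
        iso = ∈-orbit⁻ S X r o

    types>0 : 1 ≤ types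
    types>0 = ℕₚ.≤-trans (s≤s z≤n)
      (Finₚ.toℕ<n (proj₁ (type-of {proj₁ (clo-exists S X)} (proj₂ (clo-exists S X)))))

    rep-distinct : ∀ i j → rep i ∈ orbit S X (rep j) → i ≡ j
    rep-distinct i j o with Finₚ.<-cmp i j
    ... | tri≈ _ e _ = e
    ... | tri> _ _ p = contradiction o (allPairs-lookup (distinct R) j i p)
    ... | tri< p _ _ = contradiction (orbit-sym S X {rep j} {rep i} o) (allPairs-lookup (distinct R) i j p)

    -- Any two orderings of the empty space agree, so all representatives share one orbit.
    types-empty : ¬ (1 ≤ size X) → types ≡ 1
    types-empty empty = ℕₚ.≤-antisym (Finₚ.injective⇒≤ {f = λ _ → zero} λ {i} {j} _ →
      rep-distinct i j (∈-orbit⁺ S X (rep j) (rep i) (tabulate λ x → x) (iso-id S X)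
        λ x → contradiction (ℕₚ.≤-trans (s≤s z≤n) (Finₚ.toℕ<n x)) empty)) types>0

    -- Upper bound: one colour for each type of ordering.

    module Upper (Y : FUS S) (k : ℕ) {n : ℕ} (sc : Scale S n)
                 (U : Ultra (Fin (size X)) n) (pX : Presents S sc X U)
                 (V : Ultra (Fin (size Y)) n) (pY : Presents S sc Y V)
                 (ordered : ∀ i → Σ (Rep U (Before S (rep i)) n) λ T → ∀ x → ∃ λ y → label T y ≡ x)
                 (W : Tree n) where

      A : Fin types → Tree n
      A i = tree (proj₁ (ordered i))

      -- `encode` places `Y` in this tree, so every copy of its leaf space contains a copy of `Y`.
      B : Tree n
      B = regular (size Y) n

      leafOf : ∀ i → Fin (size X) → Leaf n (A i)
      leafOf i x = proj₁ (proj₂ (ordered i) x)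

      Z : FUS S
      Z = treeFUS S n sc W

      point : Leaf n W → Fin (size Z)
      point = fromLeaf S n sc W

      placement : ∀ i → Hom (Trees n) (A i) W → Fin (size X) → Fin (size Z)
      placement i e x = point (app n e (leafOf i x))

      module _ (χ : Subset (size Z) → Fin (suc k)) (f : Hom (Trees n) B W) (c : Fin types → Fin (suc k))
               (mono : ∀ i g → χ (image (placement i (comp (Trees n) f g))) ≡ c i) where

        y : Fin (size Y) → Fin (size Z)
        y b = point (app n f (encode V n b))

        y-isometric : ∀ a b → d Z (y a) (y b) ≡ d Y a b
        y-isometric = isometric-d S sc Y Z {V} {treeUltra S n sc W} pY (λ _ _ → refl) λ a b →
          trans (fromLeaf-isometric S n sc W _ _) (trans (app-isometric n f _ _) (encode-isometric V a b))

        module _ (h : Fin (size X) → Fin (size Z)) (h-iso : ∀ a b → d Z (h a) (h b) ≡ d X a b)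
                 (h⊆y : ∀ x → ∃ λ b → y b ≡ h x) where

          -- The copy `h` of `X` pulled back to the leaves of `B`, whose order gives it a type.
          q : Fin (size X) → Leaf n B
          q x = encode V n (proj₁ (h⊆y x))

          q-isometric : Isometric U (leafUltra n B) q
          q-isometric a b = trans (sym (trans (fromLeaf-isometric S n sc W _ _) (app-isometric n f (q a) (q b))))
            (trans (cong₂ (dist (treeUltra S n sc W)) (proj₂ (h⊆y a)) (proj₂ (h⊆y b)))
                   (d-isometric S sc X Z {U} {treeUltra S n sc W} pX (λ _ _ → refl) h-iso a b))

          L : Linear (On (lt n) q)
          L = linear-on (lt-linear n B) q (isometric-injective U (leafUltra n B) q-isometric)

          ordering : ∃ λ s → IsCLO S X s × Increasing (On (lt n) q) (Before S s) (λ x → x)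
          ordering = clo-of-order S sc X {U} pX (On (lt n) q) L
            (convex-on U (leafUltra n B) (lt-convex n) q q-isometric)

          -- Precomposition with the inverse `ψ` of `φ` leaves the image of `h` unchanged and turns
          -- the inherited ordering into `rep i`. The map of leaves is then increasing, so `induced`
          -- makes it a tree embedding of `A i` into `B`, and `mono` gives its colour.
          coloured : ∀ i φ → IsIso S X φ → (∀ x → lookup (proj₁ ordering) x ≡ lookup (rep i) (lookup φ x)) →
                     χ (image h) ≡ c i
          coloured i φ iφ e =
            trans (cong χ (image-cong h (placement i (comp (Trees n) f (proj₁ ind)))
                    (λ x → proj₁ (proj₂ iψ x) , trans (place≡ _) (cong h (proj₂ (proj₂ iψ x))))
                    (λ x → lookup ψ x , sym (place≡ x))))
                  (mono i (proj₁ ind))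
            where
            inverse : ∃ λ ψ → IsIso S X ψ × ∀ x → lookup φ (lookup ψ x) ≡ x
            inverse = iso-inverse S X φ iφ
            ψ : Vec (Fin (size X)) (size X)
            ψ = proj₁ inverse
            iψ : IsIso S X ψ
            iψ = proj₁ (proj₂ inverse)
            T : Rep U (Before S (rep i)) n
            T = proj₁ (ordered i)
            s : Vec (Fin (size X)) (size X)
            s = proj₁ ordering
            s-ψ : ∀ x → lookup s (lookup ψ x) ≡ lookup (rep i) x
            s-ψ x = trans (e (lookup ψ x)) (cong (lookup (rep i)) (proj₂ (proj₂ inverse) x))
            g : Leaf n (A i) → Leaf n B
            g x = q (lookup ψ (label T x))
            g-isometric : Isometric (leafUltra n (A i)) (leafUltra n B) g
            g-isometric a b = trans (q-isometric _ _)
              (trans (d-isometric S sc X X {U} {U} pX pX (proj₁ iψ) _ _) (isometric T a b))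
            g-increasing : Increasing (lt n) (lt n) g
            g-increasing a b p = reflects L (clo-linear S X {s} (proj₁ (proj₂ ordering))) (λ x → x)
              (proj₂ (proj₂ ordering))
              (subst₂ F._<_ (sym (s-ψ (label T a))) (sym (s-ψ (label T b))) (increasing T a b p))
            ind : Σ (Hom (Trees n) (A i) B) λ e → ∀ x → app n e x ≡ g x
            ind = induced n (A i) B (inhabited T) g g-isometric g-increasing
            place≡ : ∀ x → placement i (comp (Trees n) f (proj₁ ind)) x ≡ h (lookup ψ x)
            place≡ x = trans (cong point (trans (app-comp n f (proj₁ ind) (leafOf i x))
                (cong (app n f) (trans (proj₂ ind (leafOf i x))
                  (cong (q ∘ lookup ψ) (proj₂ (proj₂ (ordered i) x)))))))
              (proj₂ (h⊆y (lookup ψ x)))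

        few-colours : ∀ T → T ⊆ image y → IsCopy S X Z T → ∃ λ i → χ T ≡ lookup (tabulate c) i
        few-colours T T⊆ (h , h-iso , mem) = i , trans (cong χ (image-unique h mem))
          (trans (coloured h h-iso h⊆y i (proj₁ (proj₂ ty)) (proj₁ (proj₂ (proj₂ ty))) (proj₂ (proj₂ (proj₂ ty))))
                 (sym (lookup∘tabulate c i)))
          where
          h⊆y : ∀ x → ∃ λ b → y b ≡ h x
          h⊆y x = Equivalence.to (∈-image y (h x)) (T⊆ (Equivalence.from (mem (h x)) (x , refl)))
          ty : ∃ λ i → ∃ λ φ → IsIso S X φ ×
               ∀ x → lookup (proj₁ (ordering h h-iso h⊆y)) x ≡ lookup (rep i) (lookup φ x)
          ty = type-of {proj₁ (ordering h h-iso h⊆y)} (proj₁ (proj₂ (ordering h h-iso h⊆y)))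
          i : Fin types
          i = proj₁ ty

      Homogeneous : Set
      Homogeneous = (χ : ∀ i → Hom (Trees n) (A i) W → Fin (suc k)) →
        Σ (Hom (Trees n) B W) λ f → Σ (Fin types → Fin (suc k)) λ c →
        ∀ i g → χ i (comp (Trees n) f g) ≡ c i

      arrow : Homogeneous → Arrow S Z Y X (suc k) types
      arrow H χ = go (H (λ i e → χ (image (placement i e))))
        where
        go : (Σ (Hom (Trees n) B W) λ f → Σ (Fin types → Fin (suc k)) λ c →
              ∀ i g → χ (image (placement i (comp (Trees n) f g))) ≡ c i) →
             Σ (Subset (size Z)) λ U → IsCopy S Y Z U × Σ (Vec (Fin (suc k)) types) λ cs →
             ∀ T → T ⊆ U → IsCopy S X Z T → ∃ λ i → χ T ≡ lookup cs i
        go (f , c , mono) = image (y χ f c mono) ,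
          (y χ f c mono , y-isometric χ f c mono , ∈-image (y χ f c mono)) , tabulate c , few-colours χ f c mono

    upper : 1 ≤ size X → RamseyBound S X types
    upper 0<N = types>0 , λ { Y (suc k) _ → bound Y k (scale-for S X Y) }
      where
      bound : ∀ Y k → (∃ λ n → Σ (Scale S n) λ sc → Σ (Ultra (Fin (size X)) n) (Presents S sc X) ×
              Σ (Ultra (Fin (size Y)) n) (Presents S sc Y)) → Σ (FUS S) λ Z → Arrow S Z Y X (suc k) types
      bound Y k (n , sc , (U , pX) , (V , pY)) =
        H.Z (proj₁ hom) , H.arrow (proj₁ hom) (proj₂ hom)
        where
        ordered : ∀ i → Σ (Rep U (Before S (rep i)) n) λ T → ∀ x → ∃ λ y → label T y ≡ x
        ordered i = clo-tree 0<N sc {U} pX {rep i} (rep-clo i)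
        module H = Upper Y k sc U pX V pY ordered
        hom : Σ (Tree n) H.Homogeneous
        hom = ramsey-multi (Trees n) types (λ i → tree (proj₁ (ordered i)))
                (λ i → trees-ramsey n (tree (proj₁ (ordered i)))) (regular (size Y) n) k

    -- Lower bound: a colouring by types of which none can be avoided.

    module Lower (0<N : 1 ≤ size X) {n : ℕ} (sc : Scale S n) (U : Ultra (Fin (size X)) n) (pX : Presents S sc X U)
                 (Z : FUS S) (rZ : Vec (Fin (size Z)) (size Z)) (cZ : IsCLO S Z rZ) where

      -- The set `T` has type `i` under `rZ`, as witnessed by `v`. The witness is a vector, so the
      -- search for one is finite.
      Realises : Subset (size Z) → Fin types → Vec (Fin (size Z)) (size X) → Set
      Realises T i v = (∀ x y → d Z (lookup v x) (lookup v y) ≡ d X x y) ×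
        (∀ x y → Before S (rep i) x y → Before S rZ (lookup v x) (lookup v y)) × image (lookup v) ≡ T

      realises? : ∀ T i → Decidable (Realises T i)
      realises? T i v =
        Finₚ.all? (λ x → Finₚ.all? λ y → _≟ˢ_ S (d Z (lookup v x) (lookup v y)) (d X x y)) ×-dec
        (Finₚ.all? (λ x → Finₚ.all? λ y → (lookup (rep i) x Finₚ.<? lookup (rep i) y) →-dec
           (lookup rZ (lookup v x) Finₚ.<? lookup rZ (lookup v y))) ×-dec
         Vecₚ.≡-dec Boolₚ._≟_ (image (lookup v)) T)

      -- Two parametrisations of `T` differ by an isometry `ψ` of `X`. It carries `rep j` to
      -- `rep i`, because both describe the order that `rZ` induces on `T`, and different
      -- representatives have different orbits.
      realises-unique : ∀ {T} i j v w → Realises T i v → Realises T j w → i ≡ j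
      realises-unique {T} i j v w (v-iso , v-inc , v-im) (w-iso , w-inc , w-im) =
        rep-distinct i j (∈-orbit⁺ S X (rep j) (rep i) (tabulate ψ) ψ-isIso λ x →
          trans (ranks-unique (lookup (rep i)) s (proj₂ (proj₁ (rep-clo i))) s-sur fwd bwd x)
                (cong (lookup (rep j)) (sym (lookup∘tabulate ψ x))))
        where
        pre : ∀ x → ∃ λ y → lookup w y ≡ lookup v x
        pre = image-preimage (lookup v) (lookup w) v-im w-im
        ψ : Fin (size X) → Fin (size X)
        ψ x = proj₁ (pre x)
        ψ-isIso : IsIso S X (tabulate ψ)
        ψ-isIso = iso-of S X ψ λ x y →
          trans (sym (w-iso _ _)) (trans (cong₂ (d Z) (proj₂ (pre x)) (proj₂ (pre y))) (v-iso x y))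
        s : Fin (size X) → Fin (size X)
        s x = lookup (rep j) (ψ x)
        s-sur : ∀ y → ∃ λ x → s x ≡ y
        s-sur y = proj₁ (proj₂ ψ-isIso z) , trans (cong (lookup (rep j))
            (trans (sym (lookup∘tabulate ψ _)) (proj₂ (proj₂ ψ-isIso z)))) (proj₂ (proj₂ (proj₁ (rep-clo j)) y))
          where
          z : Fin (size X)
          z = proj₁ (proj₂ (proj₁ (rep-clo j)) y)
        fwd : ∀ x y → lookup (rep i) x F.< lookup (rep i) y → s x F.< s y
        fwd x y p = reflects (clo-linear S X {rep j} (rep-clo j)) (clo-linear S Z {rZ} cZ) (lookup w) w-inc
          (subst₂ (Before S rZ) (sym (proj₂ (pre x))) (sym (proj₂ (pre y))) (v-inc x y p))
        bwd : ∀ x y → s x F.< s y → lookup (rep i) x F.< lookup (rep i) y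
        bwd x y p = reflects (clo-linear S X {rep i} (rep-clo i)) (clo-linear S Z {rZ} cZ) (lookup v) v-inc
          (subst₂ (Before S rZ) (proj₂ (pre x)) (proj₂ (pre y)) (w-inc _ _ p))

      HasType : Subset (size Z) → Fin types → Set
      HasType T i = Any (Realises T i) (allVecs (size Z) (size X))

      pick : ∀ {T} → Dec (∃ (HasType T)) → Fin types
      pick (yes (i , _)) = i
      -- A colouring is defined on all subsets; one that realises no type gets an arbitrary colour.
      pick (no _)        = fromℕ< types>0

      pick-correct : ∀ {T i} v (w? : Dec (∃ (HasType T))) → Realises T i v → pick w? ≡ i
      pick-correct v (no ¬w) r = contradiction (_ , lose (allVecs-complete v) r) ¬w
      pick-correct {T} {i} v (yes (j , m)) r with w , _ , r′ ← find m = realises-unique j i w v r′ r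

      colour : Subset (size Z) → Fin types
      colour T = pick (Finₚ.any? λ i → Any.any? (realises? T i) (allVecs (size Z) (size X)))

      colour-correct : ∀ {T i} v → Realises T i v → colour T ≡ i
      colour-correct {T} v = pick-correct v (Finₚ.any? λ i → Any.any? (realises? T i) (allVecs (size Z) (size X)))

      -- Branching `size X` leaves room to `encode` every convex ordering of `X`.
      B : Tree n
      B = regular (size X) n

      module _ (h : Fin (leaf# S n sc B) → Fin (size Z))
               (h-iso : ∀ a b → d Z (h a) (h b) ≡ d (treeFUS S n sc B) a b) where

        pos : Leaf n B → Fin (size Z)
        pos = h ∘ fromLeaf S n sc B

        pos-d : ∀ a b → d Z (pos a) (pos b) ≡ Scale.value sc (δ n a b)
        pos-d a b = trans (h-iso _ _) (cong (Scale.value sc) (fromLeaf-isometric S n sc B a b))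

        pos-injective : ∀ {a b} → pos a ≡ pos b → a ≡ b
        pos-injective {a} {b} e = δ-zero n (Scale.value-injective sc (δ-≤ n a b) z≤n
          (trans (sym (pos-d a b)) (trans (trans (cong (d Z (pos a)) (sym e)) (d-self Z (pos a)))
                                          (sym (Scale.value-zero sc)))))

        _≺_ : Leaf n B → Leaf n B → Set
        _≺_ = On (Before S rZ) pos

        ≺-convex : Convex (leafUltra n B) _≺_
        ≺-convex a b c p q = Scale.value-reflects sc (δ-≤ n a b)
          (subst₂ (_≤ᵈ_ S) (pos-d a b) (pos-d a c) (clo-between S Z {rZ} cZ (pos a) (pos b) (pos c) p q))

        reordering : Σ (Leaf n B → Leaf n B) λ π →
                     Isometric (leafUltra n B) (leafUltra n B) π × Increasing (lt n) _≺_ π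
        reordering = reorder n 0<N _≺_ (linear-on (clo-linear S Z {rZ} cZ) pos pos-injective) ≺-convex

        module _ (i : Fin types) where

          ranked : Ultra (Fin (size X)) n
          ranked = rankUltra S sc X {U} pX {rep i} (rep-clo i)

          -- `encode` turns the order `rep i` into the order of the leaves, and the reordering turns
          -- that into the order inherited from `Z`; so this copy has type `i`.
          copy : Fin (size X) → Fin (size Z)
          copy x = pos (proj₁ reordering (encode ranked n (lookup (rep i) x)))

          copy-isometric : ∀ x y → d Z (copy x) (copy y) ≡ d X x y
          copy-isometric x y = trans (pos-d _ _) (trans (cong (Scale.value sc)
            (trans (proj₁ (proj₂ reordering) _ _) (trans (encode-isometric ranked _ _)
              (rank-isometric S sc X {U} pX {rep i} (rep-clo i) x y)))) (pX x y))

          copy-realises : Realises (image copy) i (tabulate copy)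
          copy-realises =
            (λ x y → trans (cong₂ (d Z) (lookup∘tabulate copy x) (lookup∘tabulate copy y)) (copy-isometric x y)) ,
            (λ x y p → subst₂ (Before S rZ) (sym (lookup∘tabulate copy x)) (sym (lookup∘tabulate copy y))
              (proj₂ (proj₂ reordering) _ _
                (encode-increasing ranked (rankUltra-convex S sc X {U} pX {rep i} (rep-clo i)) _ _ p))) ,
            image-cong (lookup (tabulate copy)) copy (λ x → x , sym (lookup∘tabulate copy x))
                                                     (λ x → x , lookup∘tabulate copy x)

      -- The copies of the different types inside one copy of the regular tree have different
      -- colours, so their places in the list `cs` are different.
      all-colours : ∀ {l} → (Σ (Subset (size Z)) λ T → IsCopy S (treeFUS S n sc B) Z T ×
        Σ (Vec (Fin types) l) λ cs → ∀ T′ → T′ ⊆ T → IsCopy S X Z T′ → ∃ λ i → colour T′ ≡ lookup cs i) → types ≤ l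
      all-colours {l} (T , (h , h-iso , mem) , cs , few) = Finₚ.injective⇒≤ {f = index} λ {i} {j} e →
        trans (sym (index-colour i)) (trans (cong (lookup cs) e) (index-colour j))
        where
        found : ∀ i → ∃ λ j → colour (image (copy h h-iso i)) ≡ lookup cs j
        found i = few (image (copy h h-iso i)) (image-⊆ (copy h h-iso i) λ x → Equivalence.from (mem _) (_ , refl))
          (copy h h-iso i , copy-isometric h h-iso i , ∈-image (copy h h-iso i))
        index : Fin types → Fin l
        index i = proj₁ (found i)
        index-colour : ∀ i → lookup cs (index i) ≡ i
        index-colour i = trans (sym (proj₂ (found i)))
          (colour-correct (tabulate (copy h h-iso i)) (copy-realises h h-iso i))

    lower : 1 ≤ size X → ∀ l → RamseyBound S X l → types ≤ l
    lower 0<N l (_ , bound) = go (scale-for S X X)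
      where
      go : (∃ λ n → Σ (Scale S n) λ sc → Σ (Ultra (Fin (size X)) n) (Presents S sc X) ×
            Σ (Ultra (Fin (size X)) n) (Presents S sc X)) → types ≤ l
      go (n , sc , (U , pX) , _) = H.all-colours (proj₂ target H.colour)
        where
        target : Σ (FUS S) λ Z → Arrow S Z (treeFUS S n sc (regular (size X) n)) X types l
        -- The colours are the types themselves, so the number of colours is `types`.
        target = bound (treeFUS S n sc (regular (size X) n)) types types>0
        Z : FUS S
        Z = proj₁ target
        module H = Lower 0<N sc U pX Z (proj₁ (clo-exists S Z)) (proj₂ (clo-exists S Z))

-- The empty set is the only copy of an empty space, so `Y` itself serves as `Z`, with a single
-- value of the colouring.
empty-bound : ∀ S X → ¬ (1 ≤ FUS.size X) → RamseyBound S X 1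
empty-bound S X empty = s≤s z≤n , λ Y k 0<k → Y , λ χ →
  image (λ y → y) , ((λ y → y) , (λ _ _ → refl) , ∈-image (λ y → y)) ,
  χ (image none) Vec.∷ Vec.[] ,
  λ T _ (f , _ , mem) → zero , cong χ (trans (image-unique f mem) (image-cong f none (λ i → absurd i) λ ()))
  where
  absurd : ∀ {A : Set} → Fin (FUS.size X) → A
  absurd i = ⊥-elim (empty (ℕₚ.≤-trans (s≤s z≤n) (Finₚ.toℕ<n i)))
  none : ∀ {b} → Fin 0 → Fin b
  none ()

theorem1 : (S : DistOrder) (X : FUS S) →
    ∃ λ (t : ℕ) → ∃ λ (a : ℕ) → ∃ λ (b : ℕ) →
    IsRamseyDegree S X t ×
    HasCard (IsIso S X) a × HasCard (IsCLO S X) b × (t * a ≡ b)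
theorem1 S X = degree , length (isos S X) , length (clos S X) , isDegree (1 ℕₚ.≤? FUS.size X) ,
    enumerate-card (isIso? S X) , enumerate-card (isCLO? S X) , count R
  where
  R : Transversal (orbit S X) (length (isos S X)) (clos S X)
  R = orderTypes S X
  degree : ℕ
  degree = length (reps R)
  isDegree : Dec (1 ≤ FUS.size X) → IsRamseyDegree S X degree
  isDegree (yes 0<N)  = upper S X R 0<N , lower S X R 0<N
  isDegree (no empty) = subst (RamseyBound S X) (sym (types-empty S X R empty)) (empty-bound S X empty) ,
    λ l bound → subst (_≤ l) (sym (types-empty S X R empty)) (proj₁ bound)
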